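{- Let $\Delta\ne0$ be an integer. Then $$\sum_{\substack{r_1\ge1\\ (r_1,\Delta)=1}}\ \sum_{\substack{r_2\ge1\\ (r_2,\Delta)=1}}\ \sum_{\substack{d_1\ge1\\ q\mid d_1\Rightarrow q\mid\Delta}}\ \sum_{\substack{d_2\ge1\\ q\mid d_2\Rightarrow q\mid\Delta}}\frac{\prod_{\substack{q\mid r_1r_2\\ q>3}}\left(1-\frac3q\right)^{ -1}}{[r_1^2d_1,r_2^2d_2]}\ll1,$$ i.e. this series of positive terms converges, with sum bounded by a constant depending only on $\Delta$.
   Context: $r_1,r_2,d_1,d_2$ run over positive integers; $q$ denotes primes, so "$q\mid d\Rightarrow q\mid\Delta$" means every prime factor of $d$ divides $\Delta$. $(\cdot,\cdot)$ is the gcd and $[\cdot,\cdot]$ the lcm. -}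

module Defs where

open import Data.Integer.Base as ℤ using (ℤ; +_; 1ℤ)
open import Data.Integer.Divisibility using () renaming (_∣_ to _∣ℤ_)
open import Data.Integer.GCD using () renaming (gcd to gcdℤ)
import Data.Integer.Properties as ℤ
open import Data.List.Base using (List; map; foldr; upTo)
open import Data.List.Relation.Binary.Subset.Propositional using (_⊆_)
open import Data.List.Relation.Unary.All using (All)
open import Data.List.Relation.Unary.Unique.Propositional using (Unique)
open import Data.Nat.Base as ℕ using (ℕ; suc; NonZero; s≤s)
open import Data.Nat.Divisibility using (_∣_; _∣?_; m∣m*n; n∣m*n; 0∣⇒≡0)
open import Data.Nat.LCM using (lcm; lcm-least)
open import Data.Nat.Primality using (Prime; prime?)
import Data.Nat.Properties as ℕ
open import Data.Product.Base using (_×_; _,_; Σ-syntax)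
open import Data.Rational.Base using (ℚ; 0ℚ; 1ℚ; _+_; _-_; _*_; -_; _/_; 1/_; _≤_; _<_; ∣_∣; positive) renaming (NonZero to NonZeroℚ)
open import Data.Rational.Properties using (toℚᵘ-cancel-<; toℚᵘ-fromℚᵘ; +-monoˡ-<; +-inverseʳ; pos⇒nonZero)
open import Data.Rational.Unnormalised.Base using (mkℚᵘ; *<*)
import Data.Rational.Unnormalised.Properties as ℚᵘ
open import Level using (0ℓ)
open import Relation.Binary.PropositionalEquality using (_≡_; subst; sym)
open import Relation.Nullary using (Dec; yes; no)
open import Relation.Nullary.Decidable using (_×-dec_)
open import Relation.Unary using (Pred)

-- Bishop's real numbers: regular sequences of rationals.

record ℝ : Set where
  field
    approx  : ℕ → ℚ
    regular : ∀ m n → ∣ approx m - approx n ∣ ≤ 1ℤ / suc m + 1ℤ / suc n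

open ℝ public

-- Since ∣ approx x n - x ∣ ≤ 1/(n+1), the next two relations express the
-- real inequalities x ≤ c and ∣ p - x ∣ ≤ ε.

_≤ᵣ_ : ℝ → ℚ → Set
x ≤ᵣ c = ∀ n → approx x n ≤ c + 1ℤ / suc n

∣_-_∣≤_ : ℚ → ℝ → ℚ → Set
∣ p - x ∣≤ ε = ∀ n → ∣ p - approx x n ∣ ≤ ε + 1ℤ / suc n

record FiniteSubset {A : Set} (P : Pred A 0ℓ) : Set where
  field
    elements : List A
    unique   : Unique elements
    members  : All P elements

open FiniteSubset public

sumOver : {A : Set} {P : Pred A 0ℓ} → (A → ℚ) → FiniteSubset P → ℚ
sumOver f F = foldr _+_ 0ℚ (map f (elements F))

-- The family (f a), over the a satisfying P, has sum x: the net of its finite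
-- partial sums, directed by inclusion, converges to x.
HasSum : {A : Set} → Pred A 0ℓ → (A → ℚ) → ℝ → Set
HasSum P f x =
  ∀ ε → 0ℚ < ε →
  Σ[ F₀ ∈ FiniteSubset P ]
    (∀ (F : FiniteSubset P) → elements F₀ ⊆ elements F → ∣ sumOver f F - x ∣≤ ε)

private
  3/q<1 : ∀ q .{{_ : NonZero q}} → 3 ℕ.< q → + 3 / q < 1ℚ
  3/q<1 (suc k) 3<q = toℚᵘ-cancel-<
    (ℚᵘ.<-respˡ-≃ (ℚᵘ.≃-sym (toℚᵘ-fromℚᵘ (mkℚᵘ (+ 3) k)))
      (*<* (subst (+ 3 ℤ.<_) (sym (ℤ.*-identityˡ (+ suc k))) (ℤ.+<+ 3<q))))

1-3/q≢0 : ∀ q .{{_ : NonZero q}} → 3 ℕ.< q → NonZeroℚ (1ℚ - + 3 / q)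
1-3/q≢0 q 3<q = pos⇒nonZero (1ℚ - + 3 / q) {{positive
  (subst (_< 1ℚ - + 3 / q) (+-inverseʳ (+ 3 / q)) (+-monoˡ-< (- (+ 3 / q)) (3/q<1 q 3<q)))}}

lcm≢0 : ∀ m n .{{_ : NonZero m}} .{{_ : NonZero n}} → NonZero (lcm m n)
lcm≢0 m@(suc _) n@(suc _) = ℕ.≢-nonZero λ eq →
  ℕ.≢-nonZero⁻¹ (m ℕ.* n) {{ℕ.m*n≢0 m n}}
    (0∣⇒≡0 (subst (_∣ m ℕ.* n) eq (lcm-least {m} {n} (m∣m*n n) (n∣m*n m))))

largePrimeDivisor? : ∀ n q → Dec (Prime q × q ∣ n × 3 ℕ.< q)
largePrimeDivisor? n q = prime? q ×-dec q ∣? n ×-dec 3 ℕ.<? q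

localFactor : ℕ → ℕ → ℚ
localFactor n q with largePrimeDivisor? n q
... | no  _             = 1ℚ
... | yes (_ , _ , 3<q) = 1/ (1ℚ - + 3 / q)
  where
  instance
    q≢0 : NonZero q
    q≢0 = ℕ.>-nonZero (ℕ.≤-trans (s≤s ℕ.z≤n) 3<q)

    factor≢0 : NonZeroℚ (1ℚ - + 3 / q)
    factor≢0 = 1-3/q≢0 q 3<q

-- ∏ (1 - 3/q)⁻¹ over the primes q ∣ n with q > 3. For n ≥ 1, every divisor
-- of n is at most n, so the range 0, …, n contains all of them.
primeProduct : ℕ → ℚ
primeProduct n = foldr _*_ 1ℚ (map (localFactor n) (upTo (suc n)))

-- The nonzero proofs are irrelevant, so two indices are equal as soon as
-- their four numbers are.
record Index : Set where
  constructor index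
  field
    r₁ r₂ d₁ d₂ : ℕ
    .{{r₁≢0}} : NonZero r₁
    .{{r₂≢0}} : NonZero r₂
    .{{d₁≢0}} : NonZero d₁
    .{{d₂≢0}} : NonZero d₂

record Admissible (Δ : ℤ) (i : Index) : Set where
  open Index i
  field
    r₁-coprime : gcdℤ (+ r₁) Δ ≡ 1ℤ
    r₂-coprime : gcdℤ (+ r₂) Δ ≡ 1ℤ
    d₁-primes  : ∀ q → Prime q → q ∣ d₁ → + q ∣ℤ Δ
    d₂-primes  : ∀ q → Prime q → q ∣ d₂ → + q ∣ℤ Δ

denominator : Index → ℕ
denominator i = lcm (r₁ ℕ.^ 2 ℕ.* d₁) (r₂ ℕ.^ 2 ℕ.* d₂)
  where open Index i

denominator≢0 : ∀ i → NonZero (denominator i)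
denominator≢0 (index r₁ r₂ d₁ d₂) =
  lcm≢0 (r₁ ℕ.^ 2 ℕ.* d₁) (r₂ ℕ.^ 2 ℕ.* d₂)
    {{ℕ.m*n≢0 (r₁ ℕ.^ 2) d₁ {{ℕ.m^n≢0 r₁ 2}}}}
    {{ℕ.m*n≢0 (r₂ ℕ.^ 2) d₂ {{ℕ.m^n≢0 r₂ 2}}}}

term : Index → ℚ
term i = primeProduct (r₁ ℕ.* r₂) * (1ℤ / denominator i) {{denominator≢0 i}}
  where open Index i

{-# OPTIONS --safe #-}

-- Write r₁ = a u, r₂ = a v and d₁ = b s, d₂ = b t with u, v coprime and s, t
-- coprime. As the rᵢ are coprime to Δ and the dᵢ are composed of primes of Δ,
-- [r₁² d₁, r₂² d₂] = a² u² v² b s t. The product g over the primes q > 3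
-- satisfies g (r₁ r₂) ≤ g a · g u · g v, so the series is dominated by
--   (∑ₙ g n / n²)³ · (∑_d 1 / d)³,
-- where d runs over the ∣Δ∣-smooth numbers. The second sum is at most a finite
-- product of geometric series. For the first, q ≤ (q - 3)³ for q ≥ 5 gives
-- (g n)³ ≤ n², and blocks 8ᵏ ≤ n < 8ᵏ⁺¹ again reduce it to a geometric series.

module Submission where

open import Defs
open import Data.Integer.Base as ℤ using (ℤ; 0ℤ; 1ℤ)
open import Data.Integer.GCD using () renaming (gcd to gcdℤ)
import Data.Integer.Properties as ℤ
open import Data.List.Base using (List; []; _∷_; _++_; _∷ʳ_; map; foldr; filter; deduplicate; cartesianProduct; downFrom; upTo)
import Data.List.Membership.DecPropositional as DecMembership
open import Data.List.Membership.Propositional using (_∈_; _∉_)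
open import Data.List.Membership.Propositional.Properties using (∈-∃++; ∈-++⁺ˡ; ∈-++⁺ʳ; ∈-++⁻; ∈-map⁺; ∈-cartesianProduct⁺; ∈-deduplicate⁺; ∈-filter⁺; ∈-filter⁻; ∈-downFrom⁺; ∈-downFrom⁻)
open import Data.List.Properties using (map-∘; map-cong; upTo-∷ʳ)
open import Data.List.Relation.Binary.Subset.Propositional using (_⊆_)
open import Data.List.Relation.Unary.All as All using (All; []; _∷_)
import Data.List.Relation.Unary.All.Properties as All
open import Data.List.Relation.Unary.AllPairs.Core using ([]; _∷_)
open import Data.List.Relation.Unary.Any using (here; there)
open import Data.List.Relation.Unary.Unique.DecPropositional.Properties using (deduplicate-!)
open import Data.List.Relation.Unary.Unique.Propositional using (Unique)
import Data.List.Relation.Unary.Unique.Propositional.Properties as Unique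
open import Data.Nat.Base as ℕ using (ℕ; zero; suc; NonZero; z≤n; s≤s)
open import Data.Nat.Coprimality using (Coprime; 1-coprimeTo; coprime-divisor; gcd≡1⇒coprime; coprime⇒gcd≡1; GCD≡1⇒coprime) renaming (sym to coprime-sym)
open import Data.Nat.Divisibility using (_∣_; divides; quotient; _∣?_; 1∣_; ∣1⇒≡1; 0∣⇒≡0; ∣⇒≤; ∣-trans; m∣m*n; ∣m⇒∣m*n; ∣n⇒∣m*n; *-monoˡ-∣; quotient-∣; quotient≢0)
open import Data.Nat.GCD using (gcd; gcd[m,n]∣m; gcd[m,n]∣n; gcd-GCD; gcd[m,n]≡0⇒m≡0; module GCD; GCD-*; c*gcd[m,n]≡gcd[cm,cn])
open import Data.Nat.LCM using (lcm; gcd*lcm)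
open import Data.Nat.Primality using (Prime; prime?; euclidsLemma; ¬prime[0]; ¬prime[1]; composite[4]; composite⇒¬prime; prime⇒irreducible; prime⇒nonTrivial)
open import Data.Nat.Primality.Factorisation using (factorise)
import Data.Nat.Properties as ℕ
open import Data.Nat.Solver using () renaming (module +-*-Solver to ℕSolver)
open import Data.Product.Base using (_×_; _,_; Σ-syntax; proj₁; proj₂)
open import Data.Product.Properties using (≡-dec)
open import Data.Rational.Base using (ℚ; mkℚ; 0ℚ; 1ℚ; _+_; _-_; _*_; -_; _/_; 1/_; _≤_; _<_; *≤*; ∣_∣; Positive; positive; nonNegative) renaming (NonZero to NonZeroℚ)
open import Data.Rational.Properties
open import Data.Rational.Solver using (module +-*-Solver)
open import Data.Rational.Unnormalised.Base using (mkℚᵘ) renaming (*≡* to *≡*ᵘ)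
open import Data.Sum.Base using (_⊎_; inj₁; inj₂)
open import Data.Unit.Base using (⊤; tt)
open import Function.Base using (_∘_; id)
open import Level using (0ℓ)
open import Relation.Binary.Definitions using (DecidableEquality)
open import Relation.Binary.PropositionalEquality using (_≡_; _≢_; refl; sym; trans; cong; cong₂; subst; subst₂; module ≡-Reasoning)
open import Relation.Nullary using (¬_; Dec; yes; no; contradiction)
open import Relation.Nullary.Decidable using (¬?; _×-dec_; _→-dec_; map′)
open import Relation.Unary using (Pred; Decidable; _⟨×⟩_)

-- The sum has to be exhibited as a regular sequence of rationals, so a bound on all finite partial
-- sums is not enough: for every m a finite set must be given outside which every finite partial sum
-- is at most 1/(m+1). `Summable` carries this modulus as a weight tending to infinity, because
-- weights multiply under products of families and pull back along injections. Any estimate g n ≤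
-- n^θ with θ < 1 would make the sum of g n / n² converge. The exponent 1/2 already fails at q = 5,
-- where the local factor 5/2 exceeds the square root of 5, while 2/3 works for every prime q > 3
-- without a constant factor. It also stays within rational arithmetic, since 8^(2/3) = 4.

-- Rational inequalities, integers and reciprocals as rationals

0≤1 : 0ℚ ≤ 1ℚ
0≤1 = <⇒≤ (positive⁻¹ 1ℚ)

*-mono-≤ : ∀ {a b c d} → 0ℚ ≤ a → 0ℚ ≤ d → a ≤ b → c ≤ d → a * c ≤ b * d
*-mono-≤ {a} {d = d} 0≤a 0≤d a≤b c≤d = ≤-trans
  (*-monoˡ-≤-nonNeg a {{nonNegative 0≤a}} c≤d) (*-monoʳ-≤-nonNeg d {{nonNegative 0≤d}} a≤b)

0≤* : ∀ {a b} → 0ℚ ≤ a → 0ℚ ≤ b → 0ℚ ≤ a * b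
0≤* {a} {b} 0≤a 0≤b = subst (_≤ a * b) (*-zeroˡ b) (*-monoʳ-≤-nonNeg b {{nonNegative 0≤b}} 0≤a)

1≤* : ∀ {a b} → 1ℚ ≤ a → 1ℚ ≤ b → 1ℚ ≤ a * b
1≤* {a} {b} 1≤a 1≤b = *-mono-≤ {1ℚ} {a} {1ℚ} {b} 0≤1 (≤-trans 0≤1 1≤b) 1≤a 1≤b

-≤⇒∣-∣≤ : ∀ {a b c} → a ≤ b + c → b ≤ a + c → ∣ a - b ∣ ≤ c
-≤⇒∣-∣≤ {a} {b} {c} a≤b+c b≤a+c with ∣p∣≡p∨∣p∣≡-p (a - b)
... | inj₁ eq = subst₂ _≤_ (sym eq) (solve 2 (λ b c → b :+ c :- b := c) refl b c) (+-monoˡ-≤ (- b) a≤b+c)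
  where open +-*-Solver
... | inj₂ eq = subst₂ _≤_ (trans (solve 2 (λ a b → b :- a := :- (a :- b)) refl a b) (sym eq))
                  (solve 2 (λ a c → a :+ c :- a := c) refl a c) (+-monoˡ-≤ (- a) b≤a+c)
  where open +-*-Solver

abstract
  -- Both this and `inv` are given directly in lowest terms, so order comparisons need no gcd
  -- normalisation; being abstract, they stay opaque atoms for the ring solver.
  fromℕ : ℕ → ℚ
  fromℕ n = mkℚ (ℤ.+ n) 0 (coprime-sym (1-coprimeTo n))

  fromℕ-0 : fromℕ 0 ≡ 0ℚ
  fromℕ-0 = refl

  fromℕ-1 : fromℕ 1 ≡ 1ℚ
  fromℕ-1 = refl

  fromℕ≡/1 : ∀ n → ℤ.+ n / 1 ≡ fromℕ n
  fromℕ≡/1 n = normalize-coprime (coprime-sym (1-coprimeTo n))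

  fromℕ-* : ∀ m n → fromℕ (m ℕ.* n) ≡ fromℕ m * fromℕ n
  fromℕ-* m n = trans (sym (fromℕ≡/1 (m ℕ.* n))) (cong (_/ 1) (ℤ.pos-* m n))

  fromℕ-+ : ∀ m n → fromℕ (m ℕ.+ n) ≡ fromℕ m + fromℕ n
  fromℕ-+ m n = trans (sym (fromℕ≡/1 (m ℕ.+ n)))
    (cong (_/ 1) (sym (cong₂ ℤ._+_ (ℤ.*-identityʳ (ℤ.+ m)) (ℤ.*-identityʳ (ℤ.+ n)))))

  fromℕ-mono-≤ : ∀ {m n} → m ℕ.≤ n → fromℕ m ≤ fromℕ n
  fromℕ-mono-≤ m≤n = *≤* (ℤ.*-monoʳ-≤-nonNeg (ℤ.+ 1) (ℤ.+≤+ m≤n))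

  0≤fromℕ : ∀ n → 0ℚ ≤ fromℕ n
  0≤fromℕ n = fromℕ-mono-≤ {0} {n} z≤n

  -- The junk value inv 0 = 0 makes inv multiplicative everywhere.
  inv : ℕ → ℚ
  inv zero    = 0ℚ
  inv (suc n) = mkℚ (ℤ.+ 1) n (1-coprimeTo (suc n))

  inv-0 : inv 0 ≡ 0ℚ
  inv-0 = refl

  inv-1 : inv 1 ≡ 1ℚ
  inv-1 = refl

  inv≡1/ : ∀ n .{{_ : NonZero n}} → 1ℤ / n ≡ inv n
  inv≡1/ (suc n) = normalize-coprime (1-coprimeTo (suc n))

  inv-* : ∀ m n → inv (m ℕ.* n) ≡ inv m * inv n
  inv-* zero    n       = sym (*-zeroˡ (inv n))
  inv-* (suc m) zero    = trans (cong inv (ℕ.*-zeroʳ m)) (sym (*-zeroʳ (inv (suc m))))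
  inv-* (suc m) (suc n) = sym (inv≡1/ (suc m ℕ.* suc n))

  0≤inv : ∀ n → 0ℚ ≤ inv n
  0≤inv zero    = ≤-refl
  0≤inv (suc n) = nonNegative⁻¹ (inv (suc n))

  inv-antimono-≤ : ∀ {m n} .{{_ : NonZero m}} → m ℕ.≤ n → inv n ≤ inv m
  inv-antimono-≤ {suc m} {suc n} m≤n = *≤* (ℤ.*-monoˡ-≤-nonNeg (ℤ.+ 1) (ℤ.+≤+ m≤n))

  fromℕ*inv : ∀ n .{{_ : NonZero n}} → fromℕ n * inv n ≡ 1ℚ
  fromℕ*inv (suc n) = fromℚᵘ-cong {mkℚᵘ (ℤ.+ suc n ℤ.* ℤ.+ 1) (n ℕ.+ 0)} {mkℚᵘ (ℤ.+ 1) 0}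
    (*≡*ᵘ (trans (ℤ.*-identityʳ _) (trans (ℤ.*-identityʳ _) (trans (cong (λ k → ℤ.+ suc k) (sym (ℕ.+-identityʳ n))) (sym (ℤ.*-identityˡ _))))))

  fromℕ/ : ∀ m n .{{_ : NonZero n}} → ℤ.+ m / n ≡ fromℕ m * inv n
  fromℕ/ m (suc n) = fromℚᵘ-cong {mkℚᵘ (ℤ.+ m) n} {mkℚᵘ (ℤ.+ m ℤ.* ℤ.+ 1) (n ℕ.+ 0)}
    (*≡*ᵘ (cong₂ ℤ._*_ (sym (ℤ.*-identityʳ (ℤ.+ m))) (cong (λ k → ℤ.+ suc k) (ℕ.+-identityʳ n))))

  inv≤ : ∀ ε → 0ℚ < ε → Σ[ n ∈ ℕ ] inv (suc n) ≤ ε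
  -- For ε = (m+1)/(n+1) the denominator of ε is itself the witness.
  inv≤ (mkℚ (ℤ.+ suc m) n _) _ = n , *≤* (ℤ.*-monoʳ-≤-nonNeg (ℤ.+ suc n) {ℤ.+ 1} {ℤ.+ suc m} (ℤ.+≤+ (s≤s z≤n)))
  inv≤ (mkℚ (ℤ.+ 0) n _)     0<ε with () ← positive 0<ε
  inv≤ (mkℚ ℤ.-[1+ _ ] n _)  0<ε with () ← positive 0<ε

p≤p+q : ∀ {p q} → 0ℚ ≤ q → p ≤ p + q
p≤p+q {p} {q} 0≤q = subst (_≤ p + q) (+-identityʳ p) (+-monoʳ-≤ p 0≤q)

q≤p+q : ∀ {p q} → 0ℚ ≤ p → q ≤ p + q
q≤p+q {p} {q} 0≤p = subst (_≤ p + q) (+-identityˡ q) (+-monoˡ-≤ q 0≤p)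

-- Finite sums over lists

private
  variable
    A B : Set

∑ : (A → ℚ) → List A → ℚ
∑ f xs = foldr _+_ 0ℚ (map f xs)

∑-mono-≤ : ∀ {P : Pred A 0ℓ} {f g : A → ℚ} {xs} → All P xs → (∀ {a} → P a → f a ≤ g a) → ∑ f xs ≤ ∑ g xs
∑-mono-≤ []         f≤g = ≤-refl
∑-mono-≤ (px ∷ pxs) f≤g = +-mono-≤ (f≤g px) (∑-mono-≤ pxs f≤g)

∑-++ : ∀ (f : A → ℚ) xs ys → ∑ f (xs ++ ys) ≡ ∑ f xs + ∑ f ys
∑-++ f []       ys = sym (+-identityˡ _)
∑-++ f (x ∷ xs) ys = trans (cong (f x +_) (∑-++ f xs ys)) (sym (+-assoc (f x) _ _))

∑-map : ∀ (f : B → ℚ) (h : A → B) xs → ∑ f (map h xs) ≡ ∑ (f ∘ h) xs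
∑-map f h xs = cong (foldr _+_ 0ℚ) (sym (map-∘ xs))

∑-*ˡ : ∀ c (f : A → ℚ) xs → ∑ (λ a → c * f a) xs ≡ c * ∑ f xs
∑-*ˡ c f []       = sym (*-zeroʳ c)
∑-*ˡ c f (x ∷ xs) = trans (cong (_+_ (c * f x)) (∑-*ˡ c f xs)) (sym (*-distribˡ-+ c (f x) _))

0≤∑ : ∀ {f : A → ℚ} → (∀ a → 0ℚ ≤ f a) → ∀ xs → 0ℚ ≤ ∑ f xs
0≤∑ 0≤f []       = ≤-refl
0≤∑ 0≤f (x ∷ xs) = +-mono-≤ (0≤f x) (0≤∑ 0≤f xs)

-- Induction on `xs`: an occurrence of its head is cut out of `ys`. As the head does not recur in
-- `xs`, the other entries still lie in what is left of `ys`.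
∑-mono-⊆ : ∀ {f : A → ℚ} → (∀ a → 0ℚ ≤ f a) → ∀ {xs ys} → Unique xs → xs ⊆ ys → ∑ f xs ≤ ∑ f ys
∑-mono-⊆ 0≤f {[]} {ys} _ _ = 0≤∑ 0≤f ys
∑-mono-⊆ {f = f} 0≤f {x ∷ xs} (x∉xs ∷ xs!) xs⊆ys with ∈-∃++ (xs⊆ys (here refl))
... | as , bs , refl = begin
  f x + ∑ f xs              ≤⟨ +-monoʳ-≤ (f x) (∑-mono-⊆ 0≤f xs! xs⊆as++bs) ⟩
  f x + ∑ f (as ++ bs)      ≡⟨ cong (f x +_) (∑-++ f as bs) ⟩
  f x + (∑ f as + ∑ f bs)   ≡⟨ solve 3 (λ x a b → x :+ (a :+ b) := a :+ (x :+ b)) refl (f x) (∑ f as) (∑ f bs) ⟩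
  ∑ f as + ∑ f (x ∷ bs)     ≡⟨ ∑-++ f as (x ∷ bs) ⟨
  ∑ f (as ++ x ∷ bs)        ∎
  where
  open ≤-Reasoning
  open +-*-Solver
  xs⊆as++bs : xs ⊆ as ++ bs
  xs⊆as++bs z∈xs with ∈-++⁻ as (xs⊆ys (there z∈xs))
  ... | inj₁ z∈as         = ∈-++⁺ˡ z∈as
  ... | inj₂ (here refl)  = contradiction refl (All.lookup x∉xs z∈xs)
  ... | inj₂ (there z∈bs) = ∈-++⁺ʳ as z∈bs

∑-cartesianProduct : ∀ (f : A → ℚ) (g : B → ℚ) xs ys →
  ∑ (λ (a , b) → f a * g b) (cartesianProduct xs ys) ≡ ∑ f xs * ∑ g ys
∑-cartesianProduct f g []       ys = sym (*-zeroˡ (∑ g ys))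
∑-cartesianProduct {A = A} {B = B} f g (x ∷ xs) ys = begin
  ∑ fg (map (x ,_) ys ++ cartesianProduct xs ys)       ≡⟨ ∑-++ fg (map (x ,_) ys) _ ⟩
  ∑ fg (map (x ,_) ys) + ∑ fg (cartesianProduct xs ys) ≡⟨ cong₂ _+_ (∑-map fg (x ,_) ys) (∑-cartesianProduct f g xs ys) ⟩
  ∑ (λ b → f x * g b) ys + ∑ f xs * ∑ g ys             ≡⟨ cong (_+ ∑ f xs * ∑ g ys) (∑-*ˡ (f x) g ys) ⟩
  f x * ∑ g ys + ∑ f xs * ∑ g ys                       ≡⟨ *-distribʳ-+ (∑ g ys) (f x) (∑ f xs) ⟨
  (f x + ∑ f xs) * ∑ g ys                              ∎
  where
  open ≡-Reasoning
  fg : A × B → ℚ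
  fg (a , b) = f a * g b

∑-filter : ∀ {P : Pred A 0ℓ} (f : A → ℚ) (P? : Decidable P) xs → ∑ f xs ≡ ∑ f (filter P? xs) + ∑ f (filter (¬? ∘ P?) xs)
∑-filter f P? [] = refl
∑-filter f P? (x ∷ xs) with P? x
... | yes _ = trans (cong (f x +_) (∑-filter f P? xs)) (sym (+-assoc (f x) _ _))
... | no  _ = trans (cong (f x +_) (∑-filter f P? xs))
  (solve 3 (λ x a b → x :+ (a :+ b) := a :+ (x :+ b)) refl (f x) (∑ f (filter P? xs)) (∑ f (filter (¬? ∘ P?) xs)))
  where open +-*-Solver

-- Weighted summability and its closure properties

-- Summability with an effective tail (Rankin's trick): f stays summable when
-- multiplied by a weight that is at least K outside a finite list, so the sum
-- of f outside that list is at most bound / K.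
record Summable (P : Pred A 0ℓ) (f : A → ℚ) : Set where
  field
    weight       : A → ℕ
    1≤weight     : ∀ a → 1 ℕ.≤ weight a
    bound        : ℕ
    ∑≤bound      : ∀ {xs} → Unique xs → All P xs → ∑ (λ a → f a * fromℕ (weight a)) xs ≤ fromℕ bound
    small        : ℕ → List A
    weight-large : ∀ K {a} → P a → a ∉ small K → K ℕ.≤ weight a

-- With `k` inverting `h` on the list, `xs` is the `k`-image of `map h xs`, and a list is free of
-- repetitions as soon as some image of it is.
Unique-map-on : ∀ (h : A → B) (k : B → A) {xs} → All (λ a → k (h a) ≡ a) xs → Unique xs → Unique (map h xs)
Unique-map-on h k {xs} kh≡id xs! = Unique.map⁻ {f = k} (subst Unique (sym (kh-map kh≡id)) xs!)
  where
  kh-map : ∀ {xs} → All (λ a → k (h a) ≡ a) xs → map k (map h xs) ≡ xs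
  kh-map []         = refl
  kh-map (eq ∷ eqs) = cong₂ _∷_ eq (kh-map eqs)

-- Comparison test along an injection. Injectivity is given by an explicit left inverse because `k`
-- also pulls the finite lists `small K` back from `B` to `A`.
summable-transport : {P : Pred A 0ℓ} {Q : Pred B 0ℓ} {f : A → ℚ} {g : B → ℚ} (h : A → B) (k : B → A) → (∀ {a} → P a → k (h a) ≡ a) →
  (∀ {a} → P a → Q (h a)) → (∀ {a} → P a → f a ≤ g (h a)) → Summable Q g → Summable P f
summable-transport {P = P} {Q = Q} {f = f} {g = g} h k kh≡id P⇒Q f≤g S = record
  { weight       = S.weight ∘ h
  ; 1≤weight     = S.1≤weight ∘ h
  ; bound        = S.bound
  ; ∑≤bound      = λ {xs} xs! pxs → begin
      ∑ (λ a → f a * fromℕ (S.weight (h a))) xs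
        ≤⟨ ∑-mono-≤ pxs (λ pa → *-monoʳ-≤-nonNeg _ {{nonNegative (0≤fromℕ (S.weight (h _)))}} (f≤g pa)) ⟩
      ∑ (λ a → g (h a) * fromℕ (S.weight (h a))) xs
        ≡⟨ ∑-map _ h xs ⟨
      ∑ (λ b → g b * fromℕ (S.weight b)) (map h xs)
        ≤⟨ S.∑≤bound (Unique-map-on h k (All.map kh≡id pxs) xs!) (All.map⁺ (All.map P⇒Q pxs)) ⟩
      fromℕ S.bound ∎
  ; small        = map k ∘ S.small
  ; weight-large = λ K pa a∉ → S.weight-large K (P⇒Q pa)
      (λ ha∈ → a∉ (subst (_∈ map k (S.small K)) (kh≡id pa) (∈-map⁺ k ha∈)))
  }
  where
  module S = Summable S
  open ≤-Reasoning

-- A finite set of pairs lies in the rectangle spanned by its two projections, over which the sum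
-- factors. A pair outside the product of the small lists has one coordinate outside its own list;
-- that coordinate supplies weight K and the other at least 1. Decidable equality serves to
-- deduplicate the projections and to find the large coordinate.
summable-× : DecidableEquality A → DecidableEquality B → {P : Pred A 0ℓ} {Q : Pred B 0ℓ} {f : A → ℚ} {g : B → ℚ} →
  (∀ a → 0ℚ ≤ f a) → (∀ b → 0ℚ ≤ g b) → Summable P f → Summable Q g →
  Summable (P ⟨×⟩ Q) (λ (a , b) → f a * g b)
summable-× {A} {B} _≟ᴬ_ _≟ᴮ_ {P} {Q} {f} {g} 0≤f 0≤g S T = record
  { weight       = λ (a , b) → S.weight a ℕ.* T.weight b
  ; 1≤weight     = λ (a , b) → ℕ.*-mono-≤ (S.1≤weight a) (T.1≤weight b)
  ; bound        = S.bound ℕ.* T.bound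
  ; ∑≤bound      = ∑≤bound
  ; small        = λ K → cartesianProduct (S.small K) (T.small K)
  ; weight-large = weight-large
  }
  where
  module S = Summable S
  module T = Summable T
  open ≤-Reasoning
  open DecMembership _≟ᴬ_ using (_∈?_)

  F : A → ℚ
  F a = f a * fromℕ (S.weight a)

  G : B → ℚ
  G b = g b * fromℕ (T.weight b)

  0≤F : ∀ a → 0ℚ ≤ F a
  0≤F a = 0≤* (0≤f a) (0≤fromℕ (S.weight a))

  0≤G : ∀ b → 0ℚ ≤ G b
  0≤G b = 0≤* (0≤g b) (0≤fromℕ (T.weight b))

  regroup : ∀ ((a , b) : A × B) → f a * g b * fromℕ (S.weight a ℕ.* T.weight b) ≡ F a * G b
  regroup (a , b) = trans (cong (f a * g b *_) (fromℕ-* (S.weight a) (T.weight b)))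
    (solve 4 (λ x y u v → x :* y :* (u :* v) := x :* u :* (y :* v)) refl (f a) (g b) _ _)
    where open +-*-Solver

  ∑≤bound : ∀ {xs} → Unique xs → All (P ⟨×⟩ Q) xs →
    ∑ (λ (a , b) → f a * g b * fromℕ (S.weight a ℕ.* T.weight b)) xs ≤ fromℕ (S.bound ℕ.* T.bound)
  ∑≤bound {xs} xs! pxs = begin
    ∑ (λ (a , b) → f a * g b * fromℕ (S.weight a ℕ.* T.weight b)) xs
      ≡⟨ cong (foldr _+_ 0ℚ) (map-cong regroup xs) ⟩
    ∑ (λ (a , b) → F a * G b) xs
      ≤⟨ ∑-mono-⊆ (λ (a , b) → 0≤* (0≤F a) (0≤G b)) xs! xs⊆as×bs ⟩
    ∑ (λ (a , b) → F a * G b) (cartesianProduct as bs)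
      ≡⟨ ∑-cartesianProduct F G as bs ⟩
    ∑ F as * ∑ G bs
      ≤⟨ *-mono-≤ (0≤∑ 0≤F as) (0≤fromℕ T.bound)
           (S.∑≤bound (deduplicate-! _≟ᴬ_ _) pas) (T.∑≤bound (deduplicate-! _≟ᴮ_ _) pbs) ⟩
    fromℕ S.bound * fromℕ T.bound
      ≡⟨ fromℕ-* S.bound T.bound ⟨
    fromℕ (S.bound ℕ.* T.bound) ∎
    where
    as : List A
    as = deduplicate _≟ᴬ_ (map proj₁ xs)

    bs : List B
    bs = deduplicate _≟ᴮ_ (map proj₂ xs)

    pas : All P as
    pas = All.deduplicate⁺ _≟ᴬ_ (All.map⁺ (All.map proj₁ pxs))

    pbs : All Q bs
    pbs = All.deduplicate⁺ _≟ᴮ_ (All.map⁺ (All.map proj₂ pxs))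

    xs⊆as×bs : xs ⊆ cartesianProduct as bs
    xs⊆as×bs x∈xs = ∈-cartesianProduct⁺
      (∈-deduplicate⁺ _≟ᴬ_ (∈-map⁺ proj₁ x∈xs))
      (∈-deduplicate⁺ _≟ᴮ_ (∈-map⁺ proj₂ x∈xs))

  weight-large : ∀ K {ab} → (P ⟨×⟩ Q) ab → ab ∉ cartesianProduct (S.small K) (T.small K) →
    K ℕ.≤ S.weight (proj₁ ab) ℕ.* T.weight (proj₂ ab)
  weight-large K {a , b} (pa , qb) ab∉ with a ∈? S.small K
  ... | no  a∉ = ℕ.≤-trans (S.weight-large K pa a∉)
    (ℕ.m≤m*n (S.weight a) (T.weight b) {{ℕ.>-nonZero (T.1≤weight b)}})
  ... | yes a∈ = ℕ.≤-trans (T.weight-large K qb (λ b∈ → ab∉ (∈-cartesianProduct⁺ a∈ b∈)))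
    (ℕ.m≤n*m (T.weight b) (S.weight a) {{ℕ.>-nonZero (S.1≤weight a)}})

summable⇒∑≤bound : {P : Pred A 0ℓ} {f : A → ℚ} → (∀ a → 0ℚ ≤ f a) → (S : Summable P f) →
  ∀ {xs} → Unique xs → All P xs → ∑ f xs ≤ fromℕ (Summable.bound S)
summable⇒∑≤bound {f = f} 0≤f S {xs} xs! pxs = ≤-trans
  (∑-mono-≤ {f = f} pxs (λ {a} _ → subst (_≤ f a * fromℕ (weight a)) (*-identityʳ (f a))
    (*-monoˡ-≤-nonNeg (f a) {{nonNegative (0≤f a)}} (subst (_≤ fromℕ (weight a)) fromℕ-1 (fromℕ-mono-≤ (1≤weight a))))))
  (∑≤bound xs! pxs)
  where open Summable S

-- The sum of a summable family as a real number

module _ (_≟_ : DecidableEquality A) {P : Pred A 0ℓ} (P? : Decidable P)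
         {f : A → ℚ} (0≤f : ∀ a → 0ℚ ≤ f a) (S : Summable P f) where

  open Summable S
  open DecMembership _≟_ using (_∈?_)

  private
    -- The tail outside `small K` is at most bound / K. The value (bound + 1)(m + 1) is nonzero and
    -- brings this below 1/(m + 1).
    K : ℕ → ℕ
    K m = suc bound ℕ.* suc m

  -- The lists `small` may repeat entries or leave `P`; turning them into finite subsets is what
  -- decidability of `P` is for.
  bulk : ℕ → FiniteSubset P
  bulk m = record
    { elements = filter P? (deduplicate _≟_ (small (K m)))
    ; unique   = Unique.filter⁺ P? (deduplicate-! _≟_ (small (K m)))
    ; members  = All.all-filter P? (deduplicate _≟_ (small (K m)))
    }

  tail≤ : ∀ m {xs} → Unique xs → All P xs → All (_∉ elements (bulk m)) xs → ∑ f xs ≤ inv (suc m)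
  tail≤ m {xs} xs! pxs xs∉ = begin
    ∑ f xs                                                  ≡⟨ *-identityˡ _ ⟨
    1ℚ * ∑ f xs                                             ≡⟨ cong (_* ∑ f xs) (trans (*-comm (inv (K m)) _) (fromℕ*inv (K m))) ⟨
    inv (K m) * fromℕ (K m) * ∑ f xs                        ≡⟨ *-assoc (inv (K m)) _ _ ⟩
    inv (K m) * (fromℕ (K m) * ∑ f xs)                      ≡⟨ cong (inv (K m) *_) (∑-*ˡ (fromℕ (K m)) f xs) ⟨
    inv (K m) * ∑ (λ a → fromℕ (K m) * f a) xs              ≤⟨ mono (∑-mono-≤ (All.zip (pxs , xs∉)) K*f≤) ⟩
    inv (K m) * ∑ (λ a → f a * fromℕ (weight a)) xs         ≤⟨ mono (∑≤bound xs! pxs) ⟩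
    inv (K m) * fromℕ bound                                 ≤⟨ mono (fromℕ-mono-≤ (ℕ.n≤1+n bound)) ⟩
    inv (K m) * fromℕ (suc bound)                           ≡⟨ cong (_* fromℕ (suc bound)) (inv-* (suc bound) (suc m)) ⟩
    inv (suc bound) * inv (suc m) * fromℕ (suc bound)       ≡⟨ solve 3 (λ b m c → b :* m :* c := c :* b :* m) refl (inv (suc bound)) (inv (suc m)) (fromℕ (suc bound)) ⟩
    fromℕ (suc bound) * inv (suc bound) * inv (suc m)       ≡⟨ cong (_* inv (suc m)) (fromℕ*inv (suc bound)) ⟩
    1ℚ * inv (suc m)                                        ≡⟨ *-identityˡ _ ⟩
    inv (suc m)                                             ∎
    where
    open ≤-Reasoning
    open +-*-Solver
    mono : ∀ {p q} → p ≤ q → inv (K m) * p ≤ inv (K m) * q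
    mono = *-monoˡ-≤-nonNeg (inv (K m)) {{nonNegative (0≤inv (K m))}}
    K*f≤ : ∀ {a} → P a × a ∉ elements (bulk m) → fromℕ (K m) * f a ≤ f a * fromℕ (weight a)
    K*f≤ {a} (pa , a∉) = subst (_≤ f a * fromℕ (weight a)) (*-comm (f a) (fromℕ (K m)))
      (*-monoˡ-≤-nonNeg (f a) {{nonNegative (0≤f a)}} (fromℕ-mono-≤ (weight-large (K m) pa
        (λ a∈ → a∉ (∈-filter⁺ P? (∈-deduplicate⁺ _≟_ a∈) pa)))))

  -- The part of `G` inside `F` is a subsum of `F`; the part outside avoids `bulk m`, so it is a
  -- tail. Since `G` is arbitrary, this single estimate yields regularity of the limit and both
  -- halves of convergence.
  sumOver≤ : ∀ m (F G : FiniteSubset P) → elements (bulk m) ⊆ elements F → sumOver f G ≤ sumOver f F + inv (suc m)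
  sumOver≤ m F G bulk⊆F = begin
    ∑ f (elements G)                     ≡⟨ ∑-filter f (_∈? elements F) (elements G) ⟩
    ∑ f G∩F + ∑ f G∖F                    ≤⟨ +-mono-≤ (∑-mono-⊆ 0≤f (Unique.filter⁺ (_∈? elements F) (unique G)) G∩F⊆F)
                                                     (tail≤ m (Unique.filter⁺ F∌? (unique G))
                                                       (All.filter⁺ F∌? (members G))
                                                       (All.map (λ ∉F → ∉F ∘ bulk⊆F) (All.all-filter F∌? (elements G)))) ⟩
    ∑ f (elements F) + inv (suc m)       ∎
    where
    open ≤-Reasoning
    F∌? : Decidable (_∉ elements F)
    F∌? = ¬? ∘ (_∈? elements F)
    G∩F G∖F : List A
    G∩F = filter (_∈? elements F) (elements G)
    G∖F = filter F∌? (elements G)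
    G∩F⊆F : G∩F ⊆ elements F
    G∩F⊆F = proj₂ ∘ ∈-filter⁻ (_∈? elements F) {xs = elements G}

  limit : ℝ
  limit = record
    { approx  = λ m → sumOver f (bulk m)
    ; regular = λ m n → subst (∣ sumOver f (bulk m) - sumOver f (bulk n) ∣ ≤_)
        (sym (cong₂ _+_ (inv≡1/ (suc m)) (inv≡1/ (suc n))))
        (-≤⇒∣-∣≤
          (≤-trans (sumOver≤ n (bulk n) (bulk m) id) (+-monoʳ-≤ (sumOver f (bulk n)) (q≤p+q (0≤inv (suc m)))))
          (≤-trans (sumOver≤ m (bulk m) (bulk n) id) (+-monoʳ-≤ (sumOver f (bulk m)) (p≤p+q (0≤inv (suc n))))))
    }

  limit-hasSum : HasSum P f limit
  limit-hasSum ε 0<ε with inv≤ ε 0<ε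
  -- The upper estimate for `F` costs only the error 1/(n + 1) that comparison with the n-th
  -- approximation allows; the lower one uses that `F` contains `bulk N`, at a cost of 1/(N + 1) ≤
  -- ε.
  ... | N , inv≤ε = bulk N , λ F bulk⊆F n → subst (λ δ → ∣ sumOver f F - sumOver f (bulk n) ∣ ≤ ε + δ) (sym (inv≡1/ (suc n)))
    (-≤⇒∣-∣≤
      (≤-trans (sumOver≤ n (bulk n) F id) (+-monoʳ-≤ (sumOver f (bulk n)) (q≤p+q (<⇒≤ 0<ε))))
      (≤-trans (sumOver≤ N F (bulk n) bulk⊆F) (+-monoʳ-≤ (sumOver f F) (≤-trans inv≤ε (p≤p+q (0≤inv (suc n)))))))

  limit≤bound : limit ≤ᵣ fromℕ bound
  limit≤bound n = ≤-trans (summable⇒∑≤bound 0≤f S (unique (bulk n)) (members (bulk n)))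
    (subst (λ δ → fromℕ bound ≤ fromℕ bound + δ) (sym (inv≡1/ (suc n))) (p≤p+q (0≤inv (suc n))))

-- The weighted geometric series

⊆-downFrom : ∀ (xs : List ℕ) → Σ[ N ∈ ℕ ] xs ⊆ downFrom N
⊆-downFrom []       = 0 , λ ()
⊆-downFrom (x ∷ xs) with ⊆-downFrom xs
... | N , xs⊆ = suc x ℕ.⊔ N , λ
  { (here refl) → ∈-downFrom⁺ (ℕ.m≤m⊔n (suc x) N)
  ; (there z∈)  → ∈-downFrom⁺ (ℕ.<-≤-trans (∈-downFrom⁻ (xs⊆ z∈)) (ℕ.m≤n⊔m (suc x) N)) }

∉-downFrom⇒≥ : ∀ {n k} → k ∉ downFrom n → n ℕ.≤ k
∉-downFrom⇒≥ k∉ = ℕ.≮⇒≥ (λ k<n → k∉ (∈-downFrom⁺ k<n))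

summable-geometric : Summable (λ _ → ⊤) (λ k → inv (2 ℕ.^ k))
summable-geometric = record
  { weight       = suc
  ; 1≤weight     = λ k → s≤s z≤n
  ; bound        = 4
  ; ∑≤bound      = λ {xs} xs! _ → let N , xs⊆ = ⊆-downFrom xs in begin
      ∑ w xs                                         ≤⟨ ∑-mono-⊆ 0≤w xs! xs⊆ ⟩
      ∑ w (downFrom N)                               ≤⟨ p≤p+q (0≤* (0≤fromℕ (2 ℕ.* N ℕ.+ 4)) (0≤inv (2 ℕ.^ N))) ⟩
      ∑ w (downFrom N) + rest N                      ≡⟨ ∑-downFrom N ⟩
      fromℕ 4                                        ∎
  ; small        = downFrom
  ; weight-large = λ K _ k∉ → ℕ.m≤n⇒m≤1+n (∉-downFrom⇒≥ k∉)
  }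
  where
  open ≤-Reasoning

  -- `rest k` is the closed form of the tail, the sum of (j + 1)/2^j over j ≥ k. Its value at k = 0
  -- is the bound 4.
  w rest : ℕ → ℚ
  w k    = inv (2 ℕ.^ k) * fromℕ (suc k)
  rest k = fromℕ (2 ℕ.* k ℕ.+ 4) * inv (2 ℕ.^ k)

  0≤w : ∀ k → 0ℚ ≤ w k
  0≤w k = 0≤* (0≤inv (2 ℕ.^ k)) (0≤fromℕ (suc k))

  halve : ∀ k → inv (2 ℕ.^ k) ≡ fromℕ 2 * inv (2 ℕ.^ suc k)
  halve k = begin-equality
    inv (2 ℕ.^ k)                         ≡⟨ *-identityˡ _ ⟨
    1ℚ * inv (2 ℕ.^ k)                    ≡⟨ cong (_* inv (2 ℕ.^ k)) (fromℕ*inv 2) ⟨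
    fromℕ 2 * inv 2 * inv (2 ℕ.^ k)       ≡⟨ *-assoc (fromℕ 2) (inv 2) _ ⟩
    fromℕ 2 * (inv 2 * inv (2 ℕ.^ k))     ≡⟨ cong (fromℕ 2 *_) (inv-* 2 (2 ℕ.^ k)) ⟨
    fromℕ 2 * inv (2 ℕ.^ suc k)           ∎

  step : ∀ k → w k + rest (suc k) ≡ rest k
  step k = begin-equality
    inv (2 ℕ.^ k) * fromℕ (suc k) + rest (suc k)
      ≡⟨ cong (λ i → i * fromℕ (suc k) + rest (suc k)) (halve k) ⟩
    fromℕ 2 * h * fromℕ (suc k) + fromℕ (2 ℕ.* suc k ℕ.+ 4) * h
      ≡⟨ solve 4 (λ t h a b → t :* h :* a :+ b :* h := (t :* a :+ b) :* h) refl (fromℕ 2) h _ _ ⟩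
    (fromℕ 2 * fromℕ (suc k) + fromℕ (2 ℕ.* suc k ℕ.+ 4)) * h
      ≡⟨ cong (λ i → (i + fromℕ (2 ℕ.* suc k ℕ.+ 4)) * h) (fromℕ-* 2 (suc k)) ⟨
    (fromℕ (2 ℕ.* suc k) + fromℕ (2 ℕ.* suc k ℕ.+ 4)) * h
      ≡⟨ cong (_* h) (fromℕ-+ (2 ℕ.* suc k) (2 ℕ.* suc k ℕ.+ 4)) ⟨
    fromℕ (2 ℕ.* suc k ℕ.+ (2 ℕ.* suc k ℕ.+ 4)) * h
      ≡⟨ cong (λ i → fromℕ i * h) (ℕSolver.solve 1 (λ k → let t = con 2 :*ₙ (con 1 :+ₙ k) in
           t :+ₙ (t :+ₙ con 4) ℕSolver.:= con 2 :*ₙ (con 2 :*ₙ k :+ₙ con 4)) refl k) ⟩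
    fromℕ (2 ℕ.* (2 ℕ.* k ℕ.+ 4)) * h
      ≡⟨ cong (_* h) (trans (fromℕ-* 2 (2 ℕ.* k ℕ.+ 4)) (*-comm (fromℕ 2) _)) ⟩
    fromℕ (2 ℕ.* k ℕ.+ 4) * fromℕ 2 * h
      ≡⟨ *-assoc (fromℕ (2 ℕ.* k ℕ.+ 4)) (fromℕ 2) h ⟩
    fromℕ (2 ℕ.* k ℕ.+ 4) * (fromℕ 2 * h)
      ≡⟨ cong (fromℕ (2 ℕ.* k ℕ.+ 4) *_) (halve k) ⟨
    rest k ∎
    where
    open +-*-Solver using (solve; _:*_; _:+_; _:=_)
    open ℕSolver using (con) renaming (_:*_ to _:*ₙ_; _:+_ to _:+ₙ_)
    h : ℚ
    h = inv (2 ℕ.^ suc k)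

  ∑-downFrom : ∀ N → ∑ w (downFrom N) + rest N ≡ fromℕ 4
  ∑-downFrom zero = trans (+-identityˡ (fromℕ 4 * inv 1)) (trans (cong (fromℕ 4 *_) inv-1) (*-identityʳ (fromℕ 4)))
  ∑-downFrom (suc N) = begin-equality
    w N + ∑ w (downFrom N) + rest (suc N)     ≡⟨ solve 3 (λ a s b → a :+ s :+ b := s :+ (a :+ b)) refl (w N) _ _ ⟩
    ∑ w (downFrom N) + (w N + rest (suc N))   ≡⟨ cong (∑ w (downFrom N) +_) (step N) ⟩
    ∑ w (downFrom N) + rest N                 ≡⟨ ∑-downFrom N ⟩
    fromℕ 4                                   ∎
    where open +-*-Solver

-- Reciprocals of smooth numbers

-- Bounding the primes by size, instead of asking them to divide Δ, permits induction on `m`, which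
-- admits at most one new prime at each step.
Smooth : ℕ → Pred ℕ 0ℓ
Smooth m d = NonZero d × (∀ q → Prime q → q ∣ d → q ℕ.≤ m)

smooth-0⇒≡1 : ∀ {d} → Smooth 0 d → d ≡ 1
smooth-0⇒≡1 {d} (d≢0 , d-smooth) with factorise d {{d≢0}}
... | record { factors = []     ; isFactorisation = d≡1 } = d≡1
... | record { factors = q ∷ qs ; isFactorisation = d≡ ; factorsPrime = q-prime ∷ _ } =
  contradiction (subst Prime (ℕ.n≤0⇒n≡0 (d-smooth q q-prime (subst (q ∣_) (sym d≡) (m∣m*n _)))) q-prime) ¬prime[0]

-- splitPower p n d = (k , d′) with d = pᵏ d′; the fuel n is the maximal value of k.
splitPower : ℕ → ℕ → ℕ → ℕ × ℕ
splitPower p zero    d = 0 , d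
splitPower p (suc n) d with p ∣? d
... | no  _             = 0 , d
... | yes (divides e _) = let k , d′ = splitPower p n e in suc k , d′

splitPower-product : ∀ p n d → let k , d′ = splitPower p n d in p ℕ.^ k ℕ.* d′ ≡ d
splitPower-product p zero    d = ℕ.+-identityʳ d
splitPower-product p (suc n) d with p ∣? d
... | no  _                = ℕ.+-identityʳ d
... | yes (divides e d≡ep) = let k , d′ = splitPower p n e in begin
  p ℕ.* p ℕ.^ k ℕ.* d′      ≡⟨ ℕ.*-assoc p (p ℕ.^ k) d′ ⟩
  p ℕ.* (p ℕ.^ k ℕ.* d′)    ≡⟨ cong (p ℕ.*_) (splitPower-product p n e) ⟩
  p ℕ.* e                   ≡⟨ ℕ.*-comm p e ⟩
  e ℕ.* p                   ≡⟨ d≡ep ⟨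
  d                         ∎
  where open ≡-Reasoning

-- Fuel `d` is enough: dividing a nonzero number by p > 1 makes it strictly smaller, so the fuel
-- cannot run out before the powers of p do.
splitPower-∤ : ∀ p n d → 1 ℕ.< p → NonZero d → d ℕ.≤ n → ¬ p ∣ proj₂ (splitPower p n d)
splitPower-∤ p zero    zero _ () _
splitPower-∤ p (suc n) d 1<p d≢0 d≤n with p ∣? d
... | no  p∤d             = p∤d
... | yes (divides e d≡ep) = splitPower-∤ p n e 1<p e≢0
  (ℕ.≤-pred (ℕ.≤-trans (subst (e ℕ.<_) (sym d≡ep) (ℕ.m<m*n e p {{e≢0}} 1<p)) d≤n))
  where
  e≢0 : NonZero e
  e≢0 = ℕ.m*n≢0⇒m≢0 e {{subst NonZero d≡ep d≢0}}

-- An Euler product by induction on `m`: for prime p = m + 1, write d = p^k d′ with d′ free of p.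
-- Weakening 1/p^k to 1/2^k lets one geometric series serve every prime. For m = 0 only d = 1
-- remains, and it is matched with the term k = 0.
summable-smooth : ∀ m → Summable (Smooth m) inv
summable-smooth zero = summable-transport (λ _ → 0) (λ _ → 1) (λ s → sym (smooth-0⇒≡1 s)) (λ _ → tt)
  (λ s → ≤-reflexive (cong inv (smooth-0⇒≡1 s))) summable-geometric
summable-smooth (suc m) with prime? (suc m)
... | no ¬prime = summable-transport id id (λ _ → refl) smooth-pred (λ _ → ≤-refl) (summable-smooth m)
  where
  smooth-pred : ∀ {d} → Smooth (suc m) d → Smooth m d
  smooth-pred (d≢0 , d-smooth) = d≢0 , λ q q-prime q∣d →
    ℕ.≤-pred (ℕ.≤∧≢⇒< (d-smooth q q-prime q∣d) (λ { refl → ¬prime q-prime }))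
... | yes p-prime = summable-transport split (λ (k , d′) → p ℕ.^ k ℕ.* d′) (λ {d} _ → splitPower-product p d d)
    (λ s → tt , split-smooth s) (λ {d} _ → inv≤inv d)
    (summable-× ℕ._≟_ ℕ._≟_ (λ k → 0≤inv (2 ℕ.^ k)) 0≤inv summable-geometric (summable-smooth m))
  where
  p : ℕ
  p = suc m

  1<p : 1 ℕ.< p
  1<p = ℕ.nonTrivial⇒n>1 p {{prime⇒nonTrivial p-prime}}

  split : ℕ → ℕ × ℕ
  split d = splitPower p d d

  split-smooth : ∀ {d} → Smooth p d → Smooth m (proj₂ (split d))
  split-smooth {d} (d≢0 , d-smooth) = ℕ.m*n≢0⇒n≢0 (p ℕ.^ k) {{subst NonZero (sym d≡) d≢0}} , λ q q-prime q∣d′ →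
    ℕ.≤-pred (ℕ.≤∧≢⇒< (d-smooth q q-prime (subst (q ∣_) d≡ (∣n⇒∣m*n (p ℕ.^ k) q∣d′)))
      (λ { refl → splitPower-∤ p d d 1<p d≢0 ℕ.≤-refl q∣d′ }))
    where
    k = proj₁ (split d)
    d≡ = splitPower-product p d d

  inv≤inv : ∀ d → inv d ≤ inv (2 ℕ.^ proj₁ (split d)) * inv (proj₂ (split d))
  inv≤inv d = let k , d′ = split d in begin
    inv d                          ≡⟨ cong inv (splitPower-product p d d) ⟨
    inv (p ℕ.^ k ℕ.* d′)           ≡⟨ inv-* (p ℕ.^ k) d′ ⟩
    inv (p ℕ.^ k) * inv d′         ≤⟨ *-monoʳ-≤-nonNeg (inv d′) {{nonNegative (0≤inv d′)}}
                                        (inv-antimono-≤ {{ℕ.m^n≢0 2 k}} (ℕ.^-monoˡ-≤ k 1<p)) ⟩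
    inv (2 ℕ.^ k) * inv d′         ∎
    where open ≤-Reasoning

-- The prime product is at most n^(2/3)

∏ : (A → ℚ) → List A → ℚ
∏ f xs = foldr _*_ 1ℚ (map f xs)

LargePrimeDivisor : ℕ → ℕ → Set
LargePrimeDivisor n q = Prime q × q ∣ n × 3 ℕ.< q

localFactor≡1 : ∀ n q → ¬ LargePrimeDivisor n q → localFactor n q ≡ 1ℚ
localFactor≡1 n q ¬lpd with largePrimeDivisor? n q
... | yes lpd = contradiction lpd ¬lpd
... | no  _   = refl

localFactor-cong : ∀ m n q → LargePrimeDivisor m q → LargePrimeDivisor n q → localFactor m q ≡ localFactor n q
localFactor-cong m n q lpdₘ lpdₙ with largePrimeDivisor? m q | largePrimeDivisor? n q
... | yes _    | yes _    = refl
... | no  ¬lpd | _        = contradiction lpdₘ ¬lpd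
... | yes _    | no  ¬lpd = contradiction lpdₙ ¬lpd

-- The factor is q/(q - 3). Clearing the denominator leaves an identity that can be cubed and
-- cancelled; truncated subtraction is exact as q > 3.
localFactor*[q∸3] : ∀ n q → LargePrimeDivisor n q → localFactor n q * fromℕ (q ℕ.∸ 3) ≡ fromℕ q
localFactor*[q∸3] n q lpd with largePrimeDivisor? n q
... | no  ¬lpd = contradiction lpd ¬lpd
... | yes (_ , _ , 3<q) = begin
  x * t                                       ≡⟨ solve 3 (λ x t c → x :* t := x :* ((c :+ t) :- c :* con 1ℚ)) refl x t c ⟩
  x * ((c + t) - c * 1ℚ)                      ≡⟨ cong₂ (λ u v → x * (u - c * v)) c+t≡q (sym (fromℕ*inv q)) ⟩
  x * (fromℕ q - c * (fromℕ q * inv q))       ≡⟨ solve 4 (λ x q c i → x :* (q :- c :* (q :* i)) := x :* (con 1ℚ :- c :* i) :* q) refl x (fromℕ q) c (inv q) ⟩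
  x * (1ℚ - c * inv q) * fromℕ q              ≡⟨ cong (λ u → x * (1ℚ - u) * fromℕ q) (fromℕ/ 3 q) ⟨
  x * (1ℚ - ℤ.+ 3 / q) * fromℕ q              ≡⟨ cong (_* fromℕ q) (*-inverseˡ (1ℚ - ℤ.+ 3 / q)) ⟩
  1ℚ * fromℕ q                                ≡⟨ *-identityˡ (fromℕ q) ⟩
  fromℕ q                                     ∎
  where
  open ≡-Reasoning
  open +-*-Solver
  instance
    q≢0 : NonZero q
    q≢0 = ℕ.>-nonZero (ℕ.≤-trans (s≤s ℕ.z≤n) 3<q)
    1-3/q≢0′ : NonZeroℚ (1ℚ - ℤ.+ 3 / q)
    1-3/q≢0′ = 1-3/q≢0 q 3<q
  x t c : ℚ
  x = 1/ (1ℚ - ℤ.+ 3 / q)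
  t = fromℕ (q ℕ.∸ 3)
  c = fromℕ 3
  c+t≡q : c + t ≡ fromℕ q
  c+t≡q = trans (sym (fromℕ-+ 3 (q ℕ.∸ 3))) (cong fromℕ (ℕ.m+[n∸m]≡n (ℕ.<⇒≤ 3<q)))

module _ {n q : ℕ} (lpd : LargePrimeDivisor n q) where

  private
    x t : ℚ
    x = localFactor n q
    t = fromℕ (q ℕ.∸ 3)

    5≤q : 5 ℕ.≤ q
    -- Primality excludes q = 4, where q ≤ (q - 3)³ would fail.
    5≤q = ℕ.≤∧≢⇒< (proj₂ (proj₂ lpd)) (λ { refl → composite⇒¬prime composite[4] (proj₁ lpd) })

    t-pos : Positive t
    t-pos = positive (<-≤-trans (positive⁻¹ 1ℚ) (subst (_≤ t) fromℕ-1 (fromℕ-mono-≤ (ℕ.m<n⇒0<n∸m (proj₂ (proj₂ lpd))))))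

    instance
      _ = t-pos

    xt≡q : x * t ≡ fromℕ q
    xt≡q = localFactor*[q∸3] n q lpd

    q≤[q∸3]³ : ∀ {q} → 5 ℕ.≤ q → q ℕ.≤ (q ℕ.∸ 3) ℕ.* (q ℕ.∸ 3) ℕ.* (q ℕ.∸ 3)
    q≤[q∸3]³ (s≤s (s≤s (s≤s (s≤s (s≤s {n = k} z≤n))))) = begin
      5 ℕ.+ k                                          ≤⟨ ℕ.m≤m+n (5 ℕ.+ k) _ ⟩
      -- With q = 5 + k, the difference (2 + k)³ - (5 + k) = 3 + 11k + 6k² + k³ has nonnegative
      -- coefficients.
      5 ℕ.+ k ℕ.+ (3 ℕ.+ (11 ℕ.* k ℕ.+ (6 ℕ.* (k ℕ.* k) ℕ.+ k ℕ.* k ℕ.* k)))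
        ≡⟨ solve 1 (λ k → con 5 :+ k :+ (con 3 :+ (con 11 :* k :+ (con 6 :* (k :* k) :+ k :* k :* k)))
             := (con 2 :+ k) :* (con 2 :+ k) :* (con 2 :+ k)) refl k ⟩
      (2 ℕ.+ k) ℕ.* (2 ℕ.+ k) ℕ.* (2 ℕ.+ k)            ∎
      where
      open ℕ.≤-Reasoning
      open ℕSolver

  1≤localFactor⁺ : 1ℚ ≤ localFactor n q
  1≤localFactor⁺ = *-cancelʳ-≤-pos t (begin
    1ℚ * t     ≡⟨ *-identityˡ t ⟩
    t          ≤⟨ fromℕ-mono-≤ (ℕ.m∸n≤m q 3) ⟩
    fromℕ q    ≡⟨ xt≡q ⟨
    x * t      ∎)
    where open ≤-Reasoning

  -- This is x ≤ q^(2/3) without fractional powers. With t = q - 3 and x t = q, one has x³ t³ = q³ ≤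
  -- q² t³, and t³ cancels.
  localFactor³≤q²⁺ : localFactor n q * localFactor n q * localFactor n q ≤ fromℕ q * fromℕ q
  localFactor³≤q²⁺ = *-cancelʳ-≤-pos (t * t * t) {{pos*pos⇒pos (t * t) {{pos*pos⇒pos t t}} t}} (begin
    x * x * x * (t * t * t)                  ≡⟨ solve 2 (λ x t → x :* x :* x :* (t :* t :* t) := x :* t :* (x :* t) :* (x :* t)) refl x t ⟩
    x * t * (x * t) * (x * t)                ≡⟨ cong (λ u → u * u * u) xt≡q ⟩
    fromℕ q * fromℕ q * fromℕ q              ≤⟨ *-monoˡ-≤-nonNeg (fromℕ q * fromℕ q) {{nonNegative (0≤* (0≤fromℕ q) (0≤fromℕ q))}} q≤t³ ⟩
    fromℕ q * fromℕ q * (t * t * t)          ∎)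
    where
    open ≤-Reasoning
    open +-*-Solver
    q≤t³ : fromℕ q ≤ t * t * t
    q≤t³ = subst (fromℕ q ≤_)
      (trans (fromℕ-* ((q ℕ.∸ 3) ℕ.* (q ℕ.∸ 3)) (q ℕ.∸ 3)) (cong (_* t) (fromℕ-* (q ℕ.∸ 3) (q ℕ.∸ 3))))
      (fromℕ-mono-≤ (q≤[q∸3]³ 5≤q))

1≤localFactor : ∀ n q → 1ℚ ≤ localFactor n q
1≤localFactor n q = go (largePrimeDivisor? n q)
  where
  go : Dec (LargePrimeDivisor n q) → 1ℚ ≤ localFactor n q
  go (yes lpd)  = 1≤localFactor⁺ lpd
  go (no  ¬lpd) = ≤-reflexive (sym (localFactor≡1 n q ¬lpd))

1≤∏ : ∀ {f : A → ℚ} → (∀ a → 1ℚ ≤ f a) → ∀ xs → 1ℚ ≤ ∏ f xs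
1≤∏ 1≤f []       = ≤-refl
1≤∏ 1≤f (x ∷ xs) = 1≤* (1≤f x) (1≤∏ 1≤f xs)

0≤primeProduct : ∀ n → 0ℚ ≤ primeProduct n
0≤primeProduct n = ≤-trans 0≤1 (1≤∏ (1≤localFactor n) (upTo (suc n)))

radicalFactor : ℕ → ℕ → ℕ
radicalFactor n q with largePrimeDivisor? n q
... | yes _ = q
... | no  _ = 1

-- Over the range 0, ..., n with n ≥ 1 this is the radical of the part of n prime to 6.
radical : ℕ → List ℕ → ℕ
radical n xs = foldr ℕ._*_ 1 (map (radicalFactor n) xs)

prime∣radical⇒∈ : ∀ n xs {p} → Prime p → p ∣ radical n xs → p ∈ xs
prime∣radical⇒∈ n []       p-prime p∣1 = contradiction (subst Prime (∣1⇒≡1 p∣1) p-prime) ¬prime[1]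
prime∣radical⇒∈ n (x ∷ xs) p-prime p∣  with euclidsLemma (radicalFactor n x) _ p-prime p∣
... | inj₂ p∣xs = there (prime∣radical⇒∈ n xs p-prime p∣xs)
... | inj₁ p∣x  with largePrimeDivisor? n x
...   | no  _             = contradiction (subst Prime (∣1⇒≡1 p∣x) p-prime) ¬prime[1]
...   | yes (x-prime , _) with prime⇒irreducible x-prime p∣x
...     | inj₁ refl = contradiction p-prime ¬prime[1]
...     | inj₂ p≡x  = here p≡x

-- If n = c · `radical n xs` and a further prime x divides n, then x divides c, because the primes
-- dividing `radical n xs` are entries of `xs` and x is not.
radical∣ : ∀ n {xs} → Unique xs → radical n xs ∣ n
radical∣ n []           = 1∣ n
radical∣ n {x ∷ xs} (x∉xs ∷ xs!) with radical∣ n xs! | largePrimeDivisor? n x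
... | rad∣n | no _ = subst (_∣ n) (sym (ℕ.*-identityˡ (radical n xs))) rad∣n
... | divides c n≡c*rad | yes (x-prime , x∣n , _) with euclidsLemma c _ x-prime (subst (x ∣_) n≡c*rad x∣n)
...   | inj₁ x∣c   = subst (x ℕ.* radical n xs ∣_) (sym n≡c*rad) (*-monoˡ-∣ (radical n xs) x∣c)
...   | inj₂ x∣rad = contradiction refl (All.lookup x∉xs (prime∣radical⇒∈ n xs x-prime x∣rad))

localFactor³≤ : ∀ n q → localFactor n q * localFactor n q * localFactor n q ≤ fromℕ (radicalFactor n q) * fromℕ (radicalFactor n q)
localFactor³≤ n q = go (largePrimeDivisor? n q)
  where
  radicalFactor⁺ : LargePrimeDivisor n q → radicalFactor n q ≡ q
  radicalFactor⁺ lpd with largePrimeDivisor? n q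
  ... | yes _    = refl
  ... | no  ¬lpd = contradiction lpd ¬lpd
  radicalFactor⁻ : ¬ LargePrimeDivisor n q → radicalFactor n q ≡ 1
  radicalFactor⁻ ¬lpd with largePrimeDivisor? n q
  ... | yes lpd = contradiction lpd ¬lpd
  ... | no  _   = refl
  go : Dec (LargePrimeDivisor n q) → localFactor n q * localFactor n q * localFactor n q ≤ fromℕ (radicalFactor n q) * fromℕ (radicalFactor n q)
  go (yes lpd)  rewrite radicalFactor⁺ lpd = localFactor³≤q²⁺ lpd
  go (no  ¬lpd) rewrite radicalFactor⁻ ¬lpd | localFactor≡1 n q ¬lpd | fromℕ-1 = ≤-refl

∏-localFactor³≤ : ∀ n xs → let g = ∏ (localFactor n) xs; r = fromℕ (radical n xs) in g * g * g ≤ r * r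
∏-localFactor³≤ n [] rewrite fromℕ-1 = ≤-refl
∏-localFactor³≤ n (x ∷ xs) = begin
  l * g * (l * g) * (l * g)   ≡⟨ solve 2 (λ l g → l :* g :* (l :* g) :* (l :* g) := l :* l :* l :* (g :* g :* g)) refl l g ⟩
  l * l * l * (g * g * g)     ≤⟨ *-mono-≤ (0≤* (0≤* 0≤l 0≤l) 0≤l) (0≤* (0≤fromℕ _) (0≤fromℕ _)) (localFactor³≤ n x) (∏-localFactor³≤ n xs) ⟩
  m * m * (r * r)             ≡⟨ solve 2 (λ m r → m :* m :* (r :* r) := m :* r :* (m :* r)) refl m r ⟩
  m * r * (m * r)             ≡⟨ cong (λ u → u * u) (fromℕ-* (radicalFactor n x) (radical n xs)) ⟨
  fromℕ (radical n (x ∷ xs)) * fromℕ (radical n (x ∷ xs)) ∎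
  where
  open ≤-Reasoning
  open +-*-Solver
  l g m r : ℚ
  l = localFactor n x
  g = ∏ (localFactor n) xs
  m = fromℕ (radicalFactor n x)
  r = fromℕ (radical n xs)
  0≤l : 0ℚ ≤ l
  0≤l = ≤-trans 0≤1 (1≤localFactor n x)

primeProduct³≤n² : ∀ n .{{_ : NonZero n}} → primeProduct n * primeProduct n * primeProduct n ≤ fromℕ n * fromℕ n
primeProduct³≤n² n = ≤-trans (∏-localFactor³≤ n (upTo (suc n)))
  (*-mono-≤ (0≤fromℕ _) (0≤fromℕ n) rad≤n rad≤n)
  where
  rad≤n : fromℕ (radical n (upTo (suc n))) ≤ fromℕ n
  rad≤n = fromℕ-mono-≤ (∣⇒≤ (radical∣ n (Unique.upTo⁺ (suc n))))

*³-cancel-≤ : ∀ {a b} → 0ℚ ≤ b → a * a * a ≤ b * b * b → a ≤ b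
*³-cancel-≤ {a} {b} 0≤b a³≤b³ = ≮⇒≥ λ b<a → <-irrefl refl (begin-strict
  b * b * b     ≤⟨ *-monoʳ-≤-nonNeg b {{nonNegative 0≤b}} (*-mono-≤ 0≤b (≤-trans 0≤b (<⇒≤ b<a)) (<⇒≤ b<a) (<⇒≤ b<a)) ⟩
  a * a * b     <⟨ *-monoʳ-<-pos (a * a) {{a²-pos b<a}} b<a ⟩
  a * a * a     ≤⟨ a³≤b³ ⟩
  b * b * b     ∎)
  where
  open ≤-Reasoning
  a²-pos : b < a → Positive (a * a)
  a²-pos b<a = pos*pos⇒pos a a
    where instance _ = positive (≤-<-trans 0≤b b<a)

-- At powers of 8 the cube root is exact: (8^k)² = (4^k)³.
primeProduct≤4^ : ∀ k n .{{_ : NonZero n}} → n ℕ.≤ 8 ℕ.^ k → primeProduct n ≤ fromℕ (4 ℕ.^ k)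
primeProduct≤4^ k n n≤8^k = *³-cancel-≤ (0≤fromℕ (4 ℕ.^ k)) (begin
  g * g * g                               ≤⟨ primeProduct³≤n² n ⟩
  fromℕ n * fromℕ n                       ≤⟨ *-mono-≤ (0≤fromℕ n) (0≤fromℕ _) (fromℕ-mono-≤ n≤8^k) (fromℕ-mono-≤ n≤8^k) ⟩
  fromℕ (8 ℕ.^ k) * fromℕ (8 ℕ.^ k)       ≡⟨ fromℕ-* (8 ℕ.^ k) (8 ℕ.^ k) ⟨
  fromℕ (8 ℕ.^ k ℕ.* 8 ℕ.^ k)             ≡⟨ cong fromℕ (8²≡4³ k) ⟩
  fromℕ (4 ℕ.^ k ℕ.* 4 ℕ.^ k ℕ.* 4 ℕ.^ k) ≡⟨ fromℕ-* (4 ℕ.^ k ℕ.* 4 ℕ.^ k) (4 ℕ.^ k) ⟩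
  fromℕ (4 ℕ.^ k ℕ.* 4 ℕ.^ k) * c         ≡⟨ cong (_* c) (fromℕ-* (4 ℕ.^ k) (4 ℕ.^ k)) ⟩
  c * c * c                               ∎)
  where
  open ≤-Reasoning
  g c : ℚ
  g = primeProduct n
  c = fromℕ (4 ℕ.^ k)
  8²≡4³ : ∀ k → 8 ℕ.^ k ℕ.* 8 ℕ.^ k ≡ 4 ℕ.^ k ℕ.* 4 ℕ.^ k ℕ.* 4 ℕ.^ k
  8²≡4³ zero    = refl
  8²≡4³ (suc k) = trans (solve 1 (λ e → con 8 :* e :* (con 8 :* e) := con 64 :* (e :* e)) refl (8 ℕ.^ k))
    (trans (cong (64 ℕ.*_) (8²≡4³ k))
      (solve 1 (λ f → con 64 :* (f :* f :* f) := con 4 :* f :* (con 4 :* f) :* (con 4 :* f)) refl (4 ℕ.^ k)))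
    where open ℕSolver

-- Summing the prime product over n² in blocks

∑-downFrom-+ : ∀ (f : ℕ → ℚ) c N M → (∀ {n} → N ℕ.≤ n → n ℕ.< M ℕ.+ N → f n ≤ c) →
  ∑ f (downFrom (M ℕ.+ N)) ≤ fromℕ M * c + ∑ f (downFrom N)
∑-downFrom-+ f c N zero    f≤c = q≤p+q (≤-reflexive (sym (trans (cong (_* c) fromℕ-0) (*-zeroˡ c))))
∑-downFrom-+ f c N (suc M) f≤c = begin
  f (M ℕ.+ N) + ∑ f (downFrom (M ℕ.+ N))      ≤⟨ +-mono-≤ (f≤c (ℕ.m≤n+m N M) ℕ.≤-refl) (∑-downFrom-+ f c N M (λ N≤n n< → f≤c N≤n (ℕ.m<n⇒m<1+n n<))) ⟩
  c + (fromℕ M * c + ∑ f (downFrom N))        ≡⟨ solve 3 (λ c m s → c :+ (m :* c :+ s) := (con 1ℚ :+ m) :* c :+ s) refl c (fromℕ M) _ ⟩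
  (1ℚ + fromℕ M) * c + ∑ f (downFrom N)       ≡⟨ cong (λ u → u * c + ∑ f (downFrom N)) (trans (fromℕ-+ 1 M) (cong (_+ fromℕ M) fromℕ-1)) ⟨
  fromℕ (suc M) * c + ∑ f (downFrom N)        ∎
  where
  open ≤-Reasoning
  open +-*-Solver

8^n<8^1+n : ∀ n → 8 ℕ.^ n ℕ.< 8 ℕ.^ suc n
8^n<8^1+n n = ℕ.^-monoʳ-< 8 (s≤s (s≤s z≤n)) (ℕ.n<1+n n)

log₈ : ∀ n → Σ[ k ∈ ℕ ] (8 ℕ.^ k ℕ.≤ suc n × suc n ℕ.< 8 ℕ.^ suc k)
log₈ zero    = 0 , s≤s z≤n , s≤s (s≤s z≤n)
log₈ (suc n) with log₈ n
... | k , 8^k≤ , <8^k+1 with suc (suc n) ℕ.<? 8 ℕ.^ suc k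
...   | yes <8^ = k , ℕ.m≤n⇒m≤1+n 8^k≤ , <8^
...   | no  ≮8^ = suc k , ℕ.≮⇒≥ ≮8^ , ℕ.≤-<-trans <8^k+1 (8^n<8^1+n (suc k))

8^-unique : ∀ {j k n} → 8 ℕ.^ j ℕ.≤ n → n ℕ.< 8 ℕ.^ suc k → j ℕ.≤ k
8^-unique {j} {k} 8^j≤n n<8^k+1 = ℕ.≮⇒≥ λ k<j →
  ℕ.<-irrefl refl (ℕ.<-≤-trans n<8^k+1 (ℕ.≤-trans (ℕ.^-monoʳ-≤ 8 k<j) 8^j≤n))

n≤8^n : ∀ n → n ℕ.≤ 8 ℕ.^ n
n≤8^n zero    = z≤n
n≤8^n (suc n) = ℕ.≤-trans (s≤s (n≤8^n n)) (8^n<8^1+n n)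

primeProduct/n² : ℕ → ℚ
primeProduct/n² n = primeProduct n * inv (n ℕ.* n)

0≤primeProduct/n² : ∀ n → 0ℚ ≤ primeProduct/n² n
0≤primeProduct/n² n = 0≤* (0≤primeProduct n) (0≤inv (n ℕ.* n))

-- The block 8ᵏ ≤ n < 8ᵏ⁺¹ has 7·8ᵏ terms, each at most 4ᵏ⁺¹ / 64ᵏ, so its sum is at most 28 / 2ᵏ.
summable-primeProduct/n² : Summable NonZero primeProduct/n²
summable-primeProduct/n² = record
  { weight       = weight
  ; 1≤weight     = λ { zero → ℕ.≤-refl ; (suc n) → s≤s z≤n }
  -- Block k carries the weight k + 1, as in the geometric series, whose weighted bound is 4; the
  -- factor 28 comes from the size of a block.
  ; bound        = 28 ℕ.* 4
  ; ∑≤bound      = λ {xs} xs! _ → let N , xs⊆ = ⊆-downFrom xs in begin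
      -- Passing from N to 8^N ≥ N makes the range a union of complete blocks, apart from 0.
      ∑ w xs                              ≤⟨ ∑-mono-⊆ 0≤w xs! (λ z∈ → ∈-downFrom⁺ (ℕ.<-≤-trans (∈-downFrom⁻ (xs⊆ z∈)) (n≤8^n N))) ⟩
      ∑ w (downFrom (8 ℕ.^ N))            ≤⟨ ∑-blocks N ⟩
      fromℕ 28 * ∑ v (downFrom N)         ≤⟨ *-monoˡ-≤-nonNeg (fromℕ 28) {{nonNegative (0≤fromℕ 28)}}
                                               (Geometric.∑≤bound (Unique.downFrom⁺ N) (All.universal (λ _ → tt) (downFrom N))) ⟩
      fromℕ 28 * fromℕ 4                  ≡⟨ fromℕ-* 28 4 ⟨
      fromℕ (28 ℕ.* 4)                    ∎
  ; small        = λ K → downFrom (8 ℕ.^ K)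
  ; weight-large = weight-large
  }
  where
  open ≤-Reasoning
  module Geometric = Summable summable-geometric

  weight : ℕ → ℕ
  weight zero    = 1
  weight (suc n) = suc (proj₁ (log₈ n))

  w v : ℕ → ℚ
  w n = primeProduct/n² n * fromℕ (weight n)
  v k = inv (2 ℕ.^ k) * fromℕ (suc k)

  0≤w : ∀ n → 0ℚ ≤ w n
  0≤w n = 0≤* (0≤primeProduct/n² n) (0≤fromℕ (weight n))

  weight-large : ∀ K {n} → NonZero n → n ∉ downFrom (8 ℕ.^ K) → K ℕ.≤ weight n
  weight-large K {suc n} _ n∉ = ℕ.m≤n⇒m≤1+n
    (8^-unique {K} (∉-downFrom⇒≥ n∉) (proj₂ (proj₂ (log₈ n))))

  block-term : ℕ → ℚ
  block-term k = fromℕ (4 ℕ.^ suc k) * inv (8 ℕ.^ k ℕ.* 8 ℕ.^ k) * fromℕ (suc k)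

  w≤block-term : ∀ k {n} → 8 ℕ.^ k ℕ.≤ n → n ℕ.< 8 ℕ.^ suc k → w n ≤ block-term k
  w≤block-term k {zero}  8^k≤0 _ = contradiction (ℕ.≤-trans (ℕ.m^n>0 8 k) 8^k≤0) (λ ())
  w≤block-term k {suc n} 8^k≤ n<8^ = *-mono-≤ (0≤primeProduct/n² (suc n)) (0≤fromℕ (suc k))
    (*-mono-≤ (0≤primeProduct (suc n)) (0≤inv _) (primeProduct≤4^ (suc k) (suc n) (ℕ.<⇒≤ n<8^))
      (inv-antimono-≤ {{ℕ.m*n≢0 (8 ℕ.^ k) (8 ℕ.^ k) {{ℕ.m^n≢0 8 k}} {{ℕ.m^n≢0 8 k}}}} (ℕ.*-mono-≤ 8^k≤ 8^k≤)))
    (fromℕ-mono-≤ (s≤s (8^-unique (proj₁ (proj₂ (log₈ n))) n<8^)))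

  8≡4*2 : ∀ k → 8 ℕ.^ k ≡ 4 ℕ.^ k ℕ.* 2 ℕ.^ k
  8≡4*2 zero    = refl
  8≡4*2 (suc k) = trans (cong (8 ℕ.*_) (8≡4*2 k))
    (solve 2 (λ a b → con 8 :* (a :* b) := con 4 :* a :* (con 2 :* b)) refl (4 ℕ.^ k) (2 ℕ.^ k))
    where open ℕSolver

  block-sum : ∀ k → fromℕ (7 ℕ.* 8 ℕ.^ k) * block-term k ≡ fromℕ 28 * v k
  block-sum k = begin-equality
    fromℕ (7 ℕ.* E) * (fromℕ (4 ℕ.* F) * inv (E ℕ.* E) * s)
      ≡⟨ cong₂ (λ a b → a * (b * inv (E ℕ.* E) * s)) (fromℕ-* 7 E) (fromℕ-* 4 F) ⟩
    fromℕ 7 * fromℕ E * (fromℕ 4 * fromℕ F * inv (E ℕ.* E) * s)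
      -- Of the two factors 1/8^k, one cancels the block size; the other splits as 1/4^k · 1/2^k,
      -- whose first half cancels the bound on the prime product.
      ≡⟨ cong (λ a → fromℕ 7 * fromℕ E * (fromℕ 4 * fromℕ F * a * s))
           (trans (inv-* E E) (cong (inv E *_) (trans (cong inv (8≡4*2 k)) (inv-* F T)))) ⟩
    fromℕ 7 * fromℕ E * (fromℕ 4 * fromℕ F * (inv E * (inv F * inv T)) * s)
      ≡⟨ solve 8 (λ a e b f e′ f′ t s → a :* e :* (b :* f :* (e′ :* (f′ :* t)) :* s)
           := a :* b :* ((e :* e′) :* (f :* f′) :* (t :* s))) refl
           (fromℕ 7) (fromℕ E) (fromℕ 4) (fromℕ F) (inv E) (inv F) (inv T) s ⟩
    fromℕ 7 * fromℕ 4 * (fromℕ E * inv E * (fromℕ F * inv F) * v k)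
      ≡⟨ cong₂ (λ a b → fromℕ 7 * fromℕ 4 * (a * b * v k)) (fromℕ*inv E {{ℕ.m^n≢0 8 k}}) (fromℕ*inv F {{ℕ.m^n≢0 4 k}}) ⟩
    fromℕ 7 * fromℕ 4 * (1ℚ * 1ℚ * v k)
      ≡⟨ cong₂ _*_ (sym (fromℕ-* 7 4)) (*-identityˡ (v k)) ⟩
    fromℕ 28 * v k ∎
    where
    open +-*-Solver
    E F T : ℕ
    E = 8 ℕ.^ k
    F = 4 ℕ.^ k
    T = 2 ℕ.^ k
    s : ℚ
    s = fromℕ (suc k)

  ∑-blocks : ∀ K → ∑ w (downFrom (8 ℕ.^ K)) ≤ fromℕ 28 * ∑ v (downFrom K)
  -- The range below 8^0 = 1 consists of 0 alone, whose term vanishes because `inv 0` = 0.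
  ∑-blocks zero = ≤-reflexive (trans (cong (λ u → u * fromℕ 1 + 0ℚ) w0≡0)
    (trans (cong (_+ 0ℚ) (*-zeroˡ (fromℕ 1))) (sym (*-zeroʳ (fromℕ 28)))))
    where
    w0≡0 : primeProduct/n² 0 ≡ 0ℚ
    w0≡0 = trans (cong (primeProduct 0 *_) inv-0) (*-zeroʳ (primeProduct 0))
  ∑-blocks (suc K) = begin
    ∑ w (downFrom (8 ℕ.^ suc K))
      ≡⟨ cong (∑ w ∘ downFrom) 8^K+1≡ ⟩
    ∑ w (downFrom (7 ℕ.* 8 ℕ.^ K ℕ.+ 8 ℕ.^ K))
      ≤⟨ ∑-downFrom-+ w (block-term K) (8 ℕ.^ K) (7 ℕ.* 8 ℕ.^ K) (λ {n} 8^K≤n n< → w≤block-term K 8^K≤n (subst (n ℕ.<_) (sym 8^K+1≡) n<)) ⟩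
    fromℕ (7 ℕ.* 8 ℕ.^ K) * block-term K + ∑ w (downFrom (8 ℕ.^ K))
      ≤⟨ +-mono-≤ (≤-reflexive (block-sum K)) (∑-blocks K) ⟩
    fromℕ 28 * v K + fromℕ 28 * ∑ v (downFrom K)
      ≡⟨ *-distribˡ-+ (fromℕ 28) (v K) _ ⟨
    fromℕ 28 * ∑ v (downFrom (suc K)) ∎
    where
    8^K+1≡ : 8 ℕ.^ suc K ≡ 7 ℕ.* 8 ℕ.^ K ℕ.+ 8 ℕ.^ K
    8^K+1≡ = ℕ.+-comm (8 ℕ.^ K) (7 ℕ.* 8 ℕ.^ K)

-- Submultiplicativity of the prime product

∏-∷ʳ : ∀ (f : A → ℚ) xs x → ∏ f (xs ∷ʳ x) ≡ ∏ f xs * f x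
∏-∷ʳ f []       x = *-comm (f x) 1ℚ
∏-∷ʳ f (y ∷ xs) x = trans (cong (f y *_) (∏-∷ʳ f xs x)) (sym (*-assoc (f y) _ (f x)))

∏-mono-≤ : ∀ {f g : A → ℚ} → (∀ a → 1ℚ ≤ f a) → (∀ a → f a ≤ g a) → ∀ xs → ∏ f xs ≤ ∏ g xs
∏-mono-≤ 1≤f f≤g []       = ≤-refl
∏-mono-≤ 1≤f f≤g (x ∷ xs) = *-mono-≤ (≤-trans 0≤1 (1≤f x))
  (≤-trans 0≤1 (1≤∏ (λ a → ≤-trans (1≤f a) (f≤g a)) xs)) (f≤g x) (∏-mono-≤ 1≤f f≤g xs)

∏-* : ∀ (f g : A → ℚ) xs → ∏ (λ a → f a * g a) xs ≡ ∏ f xs * ∏ g xs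
∏-* f g []       = refl
∏-* f g (x ∷ xs) = trans (cong (f x * g x *_) (∏-* f g xs))
  (solve 4 (λ a b c d → a :* b :* (c :* d) := a :* c :* (b :* d)) refl (f x) (g x) (∏ f xs) (∏ g xs))
  where open +-*-Solver

-- Numbers beyond n do not divide n and contribute factors 1. Prime products of different numbers
-- can thus be compared over a common range.
∏-upTo≡primeProduct : ∀ n .{{_ : NonZero n}} {N} → n ℕ.≤ N → ∏ (localFactor n) (upTo (suc N)) ≡ primeProduct n
∏-upTo≡primeProduct n {N} n≤N = subst (λ N → ∏ (localFactor n) (upTo (suc N)) ≡ primeProduct n) (ℕ.m∸n+n≡m n≤N) (extend (N ℕ.∸ n))
  where
  extend : ∀ j → ∏ (localFactor n) (upTo (suc (j ℕ.+ n))) ≡ primeProduct n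
  extend zero    = refl
  extend (suc j) = begin
    ∏ l (upTo (suc (suc (j ℕ.+ n))))                    ≡⟨ cong (∏ l) (upTo-∷ʳ (suc (j ℕ.+ n))) ⟨
    ∏ l (upTo (suc (j ℕ.+ n)) ∷ʳ suc (j ℕ.+ n))         ≡⟨ ∏-∷ʳ l (upTo (suc (j ℕ.+ n))) (suc (j ℕ.+ n)) ⟩
    ∏ l (upTo (suc (j ℕ.+ n))) * l (suc (j ℕ.+ n))      ≡⟨ cong₂ _*_ (extend j) (localFactor≡1 n (suc (j ℕ.+ n))
                                                             λ (_ , q∣n , _) → ℕ.<⇒≱ (s≤s (ℕ.m≤n+m n j)) (∣⇒≤ q∣n)) ⟩
    primeProduct n * 1ℚ                                 ≡⟨ *-identityʳ (primeProduct n) ⟩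
    primeProduct n                                      ∎
    where
    open ≡-Reasoning
    l = localFactor n

-- The comparison is made at each q separately: the factor of n reappears in a or b, and the
-- remaining factor on the right is at least 1.
primeProduct-≤-* : ∀ n a b .{{_ : NonZero n}} .{{_ : NonZero a}} .{{_ : NonZero b}} →
  (∀ {q} → Prime q → q ∣ n → (q ∣ a) ⊎ (q ∣ b)) → primeProduct n ≤ primeProduct a * primeProduct b
primeProduct-≤-* n a b q∣n⇒ = begin
  primeProduct n                                               ≡⟨ ∏-upTo≡primeProduct n n≤N ⟨
  ∏ (localFactor n) qs                                         ≤⟨ ∏-mono-≤ (1≤localFactor n) local qs ⟩
  ∏ (λ q → localFactor a q * localFactor b q) qs               ≡⟨ ∏-* (localFactor a) (localFactor b) qs ⟩
  ∏ (localFactor a) qs * ∏ (localFactor b) qs                  ≡⟨ cong₂ _*_ (∏-upTo≡primeProduct a a≤N) (∏-upTo≡primeProduct b b≤N) ⟩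
  primeProduct a * primeProduct b                              ∎
  where
  open ≤-Reasoning
  N : ℕ
  N = n ℕ.⊔ (a ℕ.⊔ b)
  n≤N = ℕ.m≤m⊔n n (a ℕ.⊔ b)
  a≤N = ℕ.≤-trans (ℕ.m≤m⊔n a b) (ℕ.m≤n⊔m n (a ℕ.⊔ b))
  b≤N = ℕ.≤-trans (ℕ.m≤n⊔m a b) (ℕ.m≤n⊔m n (a ℕ.⊔ b))
  qs : List ℕ
  qs = upTo (suc N)
  local : ∀ q → localFactor n q ≤ localFactor a q * localFactor b q
  local q = go (largePrimeDivisor? n q)
    where
    1≤a = 1≤localFactor a q
    1≤b = 1≤localFactor b q
    go : Dec (LargePrimeDivisor n q) → localFactor n q ≤ localFactor a q * localFactor b q
    go (no ¬lpd) = subst (_≤ localFactor a q * localFactor b q) (sym (localFactor≡1 n q ¬lpd)) (1≤* 1≤a 1≤b)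
    go (yes lpd@(q-prime , q∣n , 3<q)) with q∣n⇒ q-prime q∣n
    ... | inj₁ q∣a = begin
      localFactor n q                      ≡⟨ localFactor-cong n a q lpd (q-prime , q∣a , 3<q) ⟩
      localFactor a q                      ≡⟨ *-identityʳ (localFactor a q) ⟨
      localFactor a q * 1ℚ                 ≤⟨ *-monoˡ-≤-nonNeg (localFactor a q) {{nonNegative (≤-trans 0≤1 1≤a)}} 1≤b ⟩
      localFactor a q * localFactor b q    ∎
    ... | inj₂ q∣b = begin
      localFactor n q                      ≡⟨ localFactor-cong n b q lpd (q-prime , q∣b , 3<q) ⟩
      localFactor b q                      ≡⟨ *-identityˡ (localFactor b q) ⟨
      1ℚ * localFactor b q                 ≤⟨ *-monoʳ-≤-nonNeg (localFactor b q) {{nonNegative (≤-trans 0≤1 1≤b)}} 1≤a ⟩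
      localFactor a q * localFactor b q    ∎

-- Splitting off gcds and evaluating the lcm

-- gcdSplit m n = (a , u , v) with m = u a, n = v a and u, v coprime.
gcdSplit : ℕ → ℕ → ℕ × ℕ × ℕ
gcdSplit m n = gcd m n , quotient (gcd[m,n]∣m m n) , quotient (gcd[m,n]∣n m n)

gcdSplit-gcd≢0 : ∀ m n .{{_ : NonZero m}} → NonZero (gcd m n)
gcdSplit-gcd≢0 m n = ℕ.≢-nonZero (ℕ.≢-nonZero⁻¹ m ∘ gcd[m,n]≡0⇒m≡0)

gcdSplit-coprime : ∀ m n .{{_ : NonZero m}} → let _ , u , v = gcdSplit m n in Coprime u v
gcdSplit-coprime m n = GCD≡1⇒coprime (GCD-* {c = gcd m n} {{gcd≢0}} (subst (GCD.GCD _ _) (sym (ℕ.*-identityˡ (gcd m n)))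
  (subst₂ (λ x y → GCD.GCD x y (gcd m n)) (_∣_.equality (gcd[m,n]∣m m n)) (_∣_.equality (gcd[m,n]∣n m n)) (gcd-GCD m n))))
  where
  gcd≢0 : NonZero (gcd m n)
  gcd≢0 = gcdSplit-gcd≢0 m n

coprime-*ˡ : ∀ {m n k} → Coprime m k → Coprime n k → Coprime (m ℕ.* n) k
coprime-*ˡ m⊥k n⊥k (d∣mn , d∣k) =
  n⊥k (coprime-divisor (λ (e∣d , e∣m) → m⊥k (e∣m , ∣-trans e∣d d∣k)) d∣mn , d∣k)

coprime-*ʳ : ∀ {m n k} → Coprime k m → Coprime k n → Coprime k (m ℕ.* n)
coprime-*ʳ k⊥m k⊥n = coprime-sym (coprime-*ˡ (coprime-sym k⊥m) (coprime-sym k⊥n))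

coprime-∣ : ∀ {m m′ n n′} → m ∣ m′ → n ∣ n′ → Coprime m′ n′ → Coprime m n
coprime-∣ m∣m′ n∣n′ m′⊥n′ (d∣m , d∣n) = m′⊥n′ (∣-trans d∣m m∣m′ , ∣-trans d∣n n∣n′)

-- A common divisor has no prime factor, so it is 0-smooth and hence 1.
noCommonPrime⇒coprime : ∀ {m n} .{{_ : NonZero m}} → (∀ {q} → Prime q → q ∣ m → ¬ q ∣ n) → Coprime m n
noCommonPrime⇒coprime {m} no-prime {d} (d∣m , d∣n) = smooth-0⇒≡1
  ( ℕ.≢-nonZero (λ { refl → ℕ.≢-nonZero⁻¹ m (0∣⇒≡0 d∣m) })
  , λ q q-prime q∣d → contradiction (∣-trans q∣d d∣n) (no-prime q-prime (∣-trans q∣d d∣m)))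

-- The two arguments are c u² s and c v² t with c = a² b. The four coprimality hypotheses make the
-- cofactors coprime, so the gcd is c, and c cancels from gcd · lcm = product.
lcm-coprimeParts : ∀ a u v b s t .{{_ : NonZero a}} .{{_ : NonZero b}} →
  Coprime u v → Coprime s t → Coprime u t → Coprime s v →
  lcm ((u ℕ.* a) ℕ.^ 2 ℕ.* (s ℕ.* b)) ((v ℕ.* a) ℕ.^ 2 ℕ.* (t ℕ.* b))
    ≡ (a ℕ.* a ℕ.* (u ℕ.* u ℕ.* (v ℕ.* v))) ℕ.* (b ℕ.* (s ℕ.* t))
lcm-coprimeParts a u v b s t u⊥v s⊥t u⊥t s⊥v = ℕ.*-cancelˡ-≡ _ _ c {{c≢0}} (begin
  c ℕ.* lcm X Y                       ≡⟨ cong (ℕ._* lcm X Y) gcd≡c ⟨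
  gcd X Y ℕ.* lcm X Y                 ≡⟨ gcd*lcm X Y ⟩
  X ℕ.* Y                             ≡⟨ solve 6 (λ a u v b s t →
                                           (u :* a) :^ 2 :* (s :* b) :* ((v :* a) :^ 2 :* (t :* b))
                                           := a :* a :* b :* (a :* a :* (u :* u :* (v :* v)) :* (b :* (s :* t))))
                                           refl a u v b s t ⟩
  c ℕ.* ((a ℕ.* a ℕ.* (u ℕ.* u ℕ.* (v ℕ.* v))) ℕ.* (b ℕ.* (s ℕ.* t))) ∎)
  where
  open ≡-Reasoning
  open ℕSolver
  c X Y : ℕ
  c = a ℕ.* a ℕ.* b
  X = (u ℕ.* a) ℕ.^ 2 ℕ.* (s ℕ.* b)
  Y = (v ℕ.* a) ℕ.^ 2 ℕ.* (t ℕ.* b)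

  c≢0 : NonZero c
  c≢0 = ℕ.m*n≢0 (a ℕ.* a) b {{ℕ.m*n≢0 a a}}

  coprime : Coprime (u ℕ.* u ℕ.* s) (v ℕ.* v ℕ.* t)
  coprime = coprime-*ˡ (coprime-*ˡ u⊥ u⊥) (coprime-*ʳ (coprime-*ʳ s⊥v s⊥v) s⊥t)
    where
    u⊥ : Coprime u (v ℕ.* v ℕ.* t)
    u⊥ = coprime-*ʳ (coprime-*ʳ u⊥v u⊥v) u⊥t

  factor : ∀ a u b s → (u ℕ.* a) ℕ.^ 2 ℕ.* (s ℕ.* b) ≡ a ℕ.* a ℕ.* b ℕ.* (u ℕ.* u ℕ.* s)
  factor = solve 4 (λ a u b s → (u :* a) :^ 2 :* (s :* b) := a :* a :* b :* (u :* u :* s)) refl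

  gcd≡c : gcd X Y ≡ c
  gcd≡c = begin
    gcd X Y                                               ≡⟨ cong₂ gcd (factor a u b s) (factor a v b t) ⟩
    gcd (c ℕ.* (u ℕ.* u ℕ.* s)) (c ℕ.* (v ℕ.* v ℕ.* t))   ≡⟨ c*gcd[m,n]≡gcd[cm,cn] c _ _ ⟨
    c ℕ.* gcd (u ℕ.* u ℕ.* s) (v ℕ.* v ℕ.* t)             ≡⟨ cong (c ℕ.*_) (coprime⇒gcd≡1 coprime) ⟩
    c ℕ.* 1                                               ≡⟨ ℕ.*-identityʳ c ⟩
    c                                                     ∎

-- Decidability of indices and their encoding by parts

index-cong : ∀ {r₁ r₂ d₁ d₂ r₁′ r₂′ d₁′ d₂′}
  .{{_ : NonZero r₁}} .{{_ : NonZero r₂}} .{{_ : NonZero d₁}} .{{_ : NonZero d₂}}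
  .{{_ : NonZero r₁′}} .{{_ : NonZero r₂′}} .{{_ : NonZero d₁′}} .{{_ : NonZero d₂′}} →
  r₁ ≡ r₁′ → r₂ ≡ r₂′ → d₁ ≡ d₁′ → d₂ ≡ d₂′ → index r₁ r₂ d₁ d₂ ≡ index r₁′ r₂′ d₁′ d₂′
index-cong refl refl refl refl = refl

_≟ᴵ_ : DecidableEquality Index
index r₁ r₂ d₁ d₂ ≟ᴵ index r₁′ r₂′ d₁′ d₂′ = map′
  (λ (e₁ , e₂ , e₃ , e₄) → index-cong e₁ e₂ e₃ e₄) (λ { refl → refl , refl , refl , refl })
  (r₁ ℕ.≟ r₁′ ×-dec r₂ ℕ.≟ r₂′ ×-dec d₁ ℕ.≟ d₁′ ×-dec d₂ ℕ.≟ d₂′)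

admissible? : ∀ Δ → Decidable (Admissible Δ)
admissible? Δ (index r₁ r₂ d₁ d₂) = map′
  (λ (c₁ , c₂ , p₁ , p₂) → record { r₁-coprime = c₁ ; r₂-coprime = c₂ ; d₁-primes = p₁ ; d₂-primes = p₂ })
  (λ adm → let open Admissible adm in r₁-coprime , r₂-coprime , d₁-primes , d₂-primes)
  (gcdℤ (ℤ.+ r₁) Δ ℤ.≟ 1ℤ ×-dec gcdℤ (ℤ.+ r₂) Δ ℤ.≟ 1ℤ ×-dec primes? d₁ ×-dec primes? d₂)
  where
  primes? : ∀ d .{{_ : NonZero d}} → Dec (∀ q → Prime q → q ∣ d → q ∣ ℤ.∣ Δ ∣)
  -- The quantifier over all primes becomes bounded because q dividing d ≥ 1 forces q ≤ d.
  primes? d = map′ (λ f q q-prime q∣d → f {q} (s≤s (∣⇒≤ q∣d)) q-prime q∣d) (λ f {q} _ → f q) upTo?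
    where
    upTo? : Dec (∀ {q} → q ℕ.< suc d → Prime q → q ∣ d → q ∣ ℤ.∣ Δ ∣)
    upTo? = ℕ.allUpTo? (λ q → prime? q →-dec (q ∣? d →-dec q ∣? ℤ.∣ Δ ∣)) (suc d)

Parts : Set
Parts = (ℕ × ℕ × ℕ) × (ℕ × ℕ × ℕ)

toParts : Index → Parts
toParts i = gcdSplit r₁ r₂ , gcdSplit d₁ d₂
  where open Index i

-- suc ∘ pred only serves to make this total: it is the identity on the image of toParts.
fromParts : Parts → Index
fromParts ((a , u , v) , (b , s , t)) =
  index (suc (ℕ.pred (u ℕ.* a))) (suc (ℕ.pred (v ℕ.* a))) (suc (ℕ.pred (s ℕ.* b))) (suc (ℕ.pred (t ℕ.* b)))

fromParts-toParts : ∀ i → fromParts (toParts i) ≡ i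
fromParts-toParts (index r₁ r₂ d₁ d₂) = index-cong
  (restore r₁ (gcd[m,n]∣m r₁ r₂)) (restore r₂ (gcd[m,n]∣n r₁ r₂))
  (restore d₁ (gcd[m,n]∣m d₁ d₂)) (restore d₂ (gcd[m,n]∣n d₁ d₂))
  where
  restore : ∀ n .{{_ : NonZero n}} {m} (m∣n : m ∣ n) → suc (ℕ.pred (quotient m∣n ℕ.* m)) ≡ n
  restore n m∣n = trans (cong (suc ∘ ℕ.pred) (sym (_∣_.equality m∣n))) (ℕ.suc-pred n)

triple : (ℕ → ℚ) → ℕ × ℕ × ℕ → ℚ
triple f (x , y , z) = f x * (f y * f z)

0≤triple : ∀ {f} → (∀ n → 0ℚ ≤ f n) → ∀ t → 0ℚ ≤ triple f t
0≤triple 0≤f (x , y , z) = 0≤* (0≤f x) (0≤* (0≤f y) (0≤f z))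

summable-triple : ∀ {P f} → (∀ n → 0ℚ ≤ f n) → Summable P f → Summable (P ⟨×⟩ P ⟨×⟩ P) (triple f)
summable-triple 0≤f S = summable-× ℕ._≟_ (≡-dec ℕ._≟_ ℕ._≟_) 0≤f (λ (y , z) → 0≤* (0≤f y) (0≤f z)) S
  (summable-× ℕ._≟_ ℕ._≟_ 0≤f 0≤f S S)

-- Domination of the series

module _ (Δ : ℤ) (Δ≢0 : Δ ≢ 0ℤ) where

  private
    D : ℕ
    D = ℤ.∣ Δ ∣

    instance
      -- Here Δ ≠ 0 enters: it makes every prime dividing Δ at most the absolute value of Δ, so that
      -- d₁ and d₂ are `D`-smooth.
      D≢0 : NonZero D
      D≢0 = ℕ.≢-nonZero (Δ≢0 ∘ ℤ.∣i∣≡0⇒i≡0)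

    partsTerm : Parts → ℚ
    partsTerm (x , y) = triple primeProduct/n² x * triple inv y

    PartsPred : Pred Parts 0ℓ
    PartsPred = (NonZero ⟨×⟩ NonZero ⟨×⟩ NonZero) ⟨×⟩ (Smooth D ⟨×⟩ Smooth D ⟨×⟩ Smooth D)

    triple-≟ : DecidableEquality (ℕ × ℕ × ℕ)
    triple-≟ = ≡-dec ℕ._≟_ (≡-dec ℕ._≟_ ℕ._≟_)

    summable-partsTerm : Summable PartsPred partsTerm
    summable-partsTerm = summable-× triple-≟ triple-≟ (0≤triple 0≤primeProduct/n²) (0≤triple 0≤inv)
      (summable-triple 0≤primeProduct/n² summable-primeProduct/n²) (summable-triple 0≤inv (summable-smooth D))

    toParts-PartsPred : ∀ {i} → Admissible Δ i → PartsPred (toParts i)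
    toParts-PartsPred {index r₁ r₂ d₁ d₂} adm =
      (gcdSplit-gcd≢0 r₁ r₂ , quotient≢0 (gcd[m,n]∣m r₁ r₂) , quotient≢0 (gcd[m,n]∣n r₁ r₂)) ,
      (smooth d₁ d₁-primes (gcd[m,n]∣m d₁ d₂) ,
       smooth d₁ d₁-primes (quotient-∣ (gcd[m,n]∣m d₁ d₂)) ,
       smooth d₂ d₂-primes (quotient-∣ (gcd[m,n]∣n d₁ d₂)))
      where
      open Admissible adm
      smooth : ∀ d .{{_ : NonZero d}} → (∀ q → Prime q → q ∣ d → q ∣ D) → ∀ {e} → e ∣ d → Smooth D e
      smooth d d-primes e∣d = ℕ.≢-nonZero (λ { refl → ℕ.≢-nonZero⁻¹ d (0∣⇒≡0 e∣d) }) ,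
        λ q q-prime q∣e → ∣⇒≤ (d-primes q q-prime (∣-trans q∣e e∣d))

    denominator-toParts : ∀ i → Admissible Δ i → let (a , u , v) , (b , s , t) = toParts i in
      denominator i ≡ (a ℕ.* a ℕ.* (u ℕ.* u ℕ.* (v ℕ.* v))) ℕ.* (b ℕ.* (s ℕ.* t))
    denominator-toParts (index r₁ r₂ d₁ d₂) adm = trans
      (cong₂ lcm
        (cong₂ (λ r d → r ℕ.^ 2 ℕ.* d) (_∣_.equality a∣r₁) (_∣_.equality b∣d₁))
        (cong₂ (λ r d → r ℕ.^ 2 ℕ.* d) (_∣_.equality a∣r₂) (_∣_.equality b∣d₂)))
      (lcm-coprimeParts (gcd r₁ r₂) (quotient a∣r₁) (quotient a∣r₂) (gcd d₁ d₂) (quotient b∣d₁) (quotient b∣d₂)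
        {{gcdSplit-gcd≢0 r₁ r₂}} {{gcdSplit-gcd≢0 d₁ d₂}}
        (gcdSplit-coprime r₁ r₂) (gcdSplit-coprime d₁ d₂)
        (coprime-∣ (quotient-∣ a∣r₁) (quotient-∣ b∣d₂) (r⊥d r₁ d₂ r₁-coprime d₂-primes))
        (coprime-∣ (quotient-∣ b∣d₁) (quotient-∣ a∣r₂) (coprime-sym (r⊥d r₂ d₁ r₂-coprime d₁-primes))))
      where
      open Admissible adm
      a∣r₁ = gcd[m,n]∣m r₁ r₂
      a∣r₂ = gcd[m,n]∣n r₁ r₂
      b∣d₁ = gcd[m,n]∣m d₁ d₂
      b∣d₂ = gcd[m,n]∣n d₁ d₂
      r⊥d : ∀ r d .{{_ : NonZero r}} → gcdℤ (ℤ.+ r) Δ ≡ 1ℤ → (∀ q → Prime q → q ∣ d → q ∣ D) → Coprime r d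
      -- A prime dividing both r and d would divide Δ as well, and therefore (r, Δ) = 1.
      r⊥d r d r-coprime d-primes = noCommonPrime⇒coprime λ {q} q-prime q∣r q∣d →
        ¬prime[1] (subst Prime (gcd≡1⇒coprime (ℤ.+-injective r-coprime) (q∣r , d-primes q q-prime q∣d)) q-prime)

    primeProduct-toParts : ∀ r₁ r₂ .{{_ : NonZero r₁}} .{{_ : NonZero r₂}} → let a , u , v = gcdSplit r₁ r₂ in
      primeProduct (r₁ ℕ.* r₂) ≤ primeProduct a * (primeProduct u * primeProduct v)
    primeProduct-toParts r₁ r₂ = ≤-trans
      (primeProduct-≤-* (r₁ ℕ.* r₂) a (u ℕ.* v) {{ℕ.m*n≢0 r₁ r₂}} {{gcdSplit-gcd≢0 r₁ r₂}} {{uv≢0}} q∣r₁r₂⇒)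
      (*-monoˡ-≤-nonNeg (primeProduct a) {{nonNegative (0≤primeProduct a)}}
        (primeProduct-≤-* (u ℕ.* v) u v {{uv≢0}} (euclidsLemma u v)))
      where
      a = gcd r₁ r₂
      u = quotient (gcd[m,n]∣m r₁ r₂)
      v = quotient (gcd[m,n]∣n r₁ r₂)
      instance
        u≢0 : NonZero u
        u≢0 = quotient≢0 (gcd[m,n]∣m r₁ r₂)
        v≢0 : NonZero v
        v≢0 = quotient≢0 (gcd[m,n]∣n r₁ r₂)
      uv≢0 : NonZero (u ℕ.* v)
      uv≢0 = ℕ.m*n≢0 u v
      q∣r₁r₂⇒ : ∀ {q} → Prime q → q ∣ r₁ ℕ.* r₂ → (q ∣ a) ⊎ (q ∣ u ℕ.* v)
      q∣r₁r₂⇒ {q} q-prime q∣r₁r₂ with euclidsLemma r₁ r₂ q-prime q∣r₁r₂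
      ... | inj₁ q∣r₁ with euclidsLemma u a q-prime (subst (q ∣_) (_∣_.equality (gcd[m,n]∣m r₁ r₂)) q∣r₁)
      ...   | inj₁ q∣u = inj₂ (∣m⇒∣m*n v q∣u)
      ...   | inj₂ q∣a = inj₁ q∣a
      q∣r₁r₂⇒ {q} q-prime q∣r₁r₂ | inj₂ q∣r₂ with euclidsLemma v a q-prime (subst (q ∣_) (_∣_.equality (gcd[m,n]∣n r₁ r₂)) q∣r₂)
      ...   | inj₁ q∣v = inj₂ (∣n⇒∣m*n u q∣v)
      ...   | inj₂ q∣a = inj₁ q∣a

    term≤partsTerm : ∀ {i} → Admissible Δ i → term i ≤ partsTerm (toParts i)
    term≤partsTerm {i@(index r₁ r₂ d₁ d₂)} adm = begin
      term i
        ≡⟨ cong (primeProduct (r₁ ℕ.* r₂) *_) (inv≡1/ (denominator i) {{denominator≢0 i}}) ⟩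
      primeProduct (r₁ ℕ.* r₂) * inv (denominator i)
        ≤⟨ *-monoʳ-≤-nonNeg _ {{nonNegative (0≤inv (denominator i))}} (primeProduct-toParts r₁ r₂) ⟩
      g a * (g u * g v) * inv (denominator i)
        ≡⟨ cong (g a * (g u * g v) *_) (trans (cong inv (denominator-toParts i adm)) inv-expand) ⟩
      g a * (g u * g v) * (x * (y * z) * triple inv (b , s , t))
        -- Each of a, u, v receives one prime product and one inverse square.
        ≡⟨ solve 7 (λ a u v x y z w → a :* (u :* v) :* (x :* (y :* z) :* w)
             := a :* x :* (u :* y :* (v :* z)) :* w) refl (g a) (g u) (g v) x y z (triple inv (b , s , t)) ⟩
      partsTerm (toParts i) ∎
      where
      open ≤-Reasoning
      open +-*-Solver
      g = primeProduct
      a = gcd r₁ r₂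
      u = quotient (gcd[m,n]∣m r₁ r₂)
      v = quotient (gcd[m,n]∣n r₁ r₂)
      b = gcd d₁ d₂
      s = quotient (gcd[m,n]∣m d₁ d₂)
      t = quotient (gcd[m,n]∣n d₁ d₂)
      x y z : ℚ
      x = inv (a ℕ.* a)
      y = inv (u ℕ.* u)
      z = inv (v ℕ.* v)
      inv-expand : inv ((a ℕ.* a ℕ.* (u ℕ.* u ℕ.* (v ℕ.* v))) ℕ.* (b ℕ.* (s ℕ.* t))) ≡ x * (y * z) * triple inv (b , s , t)
      inv-expand = trans (inv-* _ (b ℕ.* (s ℕ.* t))) (cong₂ _*_
        (trans (inv-* (a ℕ.* a) _) (cong (x *_) (inv-* (u ℕ.* u) (v ℕ.* v))))
        (trans (inv-* b _) (cong (inv b *_) (inv-* s t))))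

  -- Bounds multiply along the construction, so the resulting constant is 112³ · 4^(3(1 + π)), with
  -- π the number of primes up to the absolute value of Δ.
  summable-term : Summable (Admissible Δ) term
  summable-term = summable-transport toParts fromParts (λ {i} _ → fromParts-toParts i)
    toParts-PartsPred term≤partsTerm summable-partsTerm

0≤term : ∀ i → 0ℚ ≤ term i
0≤term i = 0≤* (0≤primeProduct (r₁ ℕ.* r₂))
  (subst (0ℚ ≤_) (sym (inv≡1/ (denominator i) {{denominator≢0 i}})) (0≤inv (denominator i)))
  where open Index i

lemma4p4 : (Δ : ℤ) → Δ ≢ 0ℤ → Σ[ C ∈ ℚ ] Σ[ S ∈ ℝ ] (HasSum (Admissible Δ) term S × S ≤ᵣ C)
lemma4p4 Δ Δ≢0 = fromℕ (Summable.bound S) , limit _≟ᴵ_ (admissible? Δ) 0≤term S ,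
  limit-hasSum _≟ᴵ_ (admissible? Δ) 0≤term S , limit≤bound _≟ᴵ_ (admissible? Δ) 0≤term S
  where
  S : Summable (Admissible Δ) term
  S = summable-term Δ Δ≢0
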